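{- For every integer $n\ge 3$ there exist constants $C=C(n)>0$ and $\theta=\theta(n)\in(0,1)$, depending only on $n$, such that the following holds for every integer $m\ge 2$. Sample a uniform spanning tree $T$ of $G_{n,m}=C_n\times P_m$ by Wilson's algorithm, with the root being a vertex of one of the two boundary rings $R_0,R_{m-1}$ and with the first random walk started from a vertex of the other boundary ring. Let $L\subset T$ be the first loop-erased path produced by the algorithm. Then $L$ is a trunk of $T$, and for every integer $l\ge 0$, $$\mathbb{P}\bigl(T\text{ has a branch off }L\text{ of length at least }l\bigr)\;\le\; C\,m\,(n-1)\,\theta^{\,l}.$$
   Context: For $n\ge 3$, $m\ge 2$, the cylindrical graph $G_{n,m}=C_n\times P_m$ has vertex set $\{(i,j): i\in\mathbb{Z}_n,\ j\in\{0,\dots,m-1\}\}$ and edges $\{(i,j),(i+1,j)\}$ ($i\in\mathbb{Z}_n$, $0\le j\le m-1$) and $\{(i,j),(i,j+1)\}$ ($i\in\mathbb{Z}_n$, $0\le j\le m-2$). Its rings are $R_k=\{(i,k): i\in\mathbb{Z}_n\}$, $k=0,\dots,m-1$; the boundary rings are $R_0$ and $R_{m-1}$. A uniform spanning tree of a finite connected graph is a spanning tree chosen uniformly among all its spanning trees. Loop-erasure: for a finite path $\gamma$, its (chronological) loop-erasure is obtained by iteratively erasing cycles in chronological order: whenever the path first revisits a vertex, delete the loop formed between the two occurrences. The result is a simple path with the same endpoints as $\gamma$. Wilson's algorithm on a finite connected graph $G=(V,E)$: choose a root $r\in V$ and an ordering of $V\setminus\{r\}$. Starting with the tree $\{r\}$,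 repeatedly take the first vertex in the ordering not yet in the current tree, run (independently of the past) simple random walk from it (each step moves to a uniformly chosen neighbour) until it first hits the current tree, and add the loop-erasure of this walk to the tree. The final tree is a uniform spanning tree. A trunk of a spanning tree $T$ of $G_{n,m}$ is a simple path $L\subset T$ with $L\cap R_k\neq\varnothing$ for every $k=0,\dots,m-1$. Given a trunk $L\subset T$, every connected component $B$ of $T\setminus V(L)$ is adjacent in $T$ to a unique vertex $a(B)\in V(L)$; the corresponding branch off $L$ is the subtree induced by $V(B)\cup\{a(B)\}$, and its length is $\max_{v\in V(B)} d_T(v,a(B))$, where $d_T$ is the graph distance in $T$. -}

module Defs where

open import Algebra.Definitions.RawSemiring using (_^_)
open import Data.Bool.Base using (if_then_else_)
open import Data.Fin.Base using (Fin; toℕ)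
open import Data.Fin.Properties as Fin using (nonZeroIndex)
open import Data.Integer.Base using (+_)
open import Data.List.Base using (List; []; _∷_; _++_; _∷ʳ_; length; map; filter; foldl; foldr; reverse; dropWhile; drop; zip; allFin; cartesianProduct)
open import Data.List.Membership.Propositional using (_∈_; _∉_)
open import Data.List.Membership.Propositional.Properties using (∈-cartesianProduct⁺; ∈-allFin)
import Data.List.Membership.DecPropositional as DecMembership
open import Data.List.Relation.Unary.All using (All)
open import Data.List.Relation.Unary.Any using (Any)
open import Data.List.Relation.Unary.Linked using (Linked)
open import Data.List.Relation.Unary.Unique.Propositional using (Unique)
open import Data.List.Relation.Unary.Unique.Propositional.Properties using (allFin⁺; cartesianProduct⁺)
open import Data.Nat.Base using (ℕ; zero; suc; _≤_; _<_; _∸_)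
open import Data.Nat.DivMod using (_%_)
open import Data.Nat.Properties as ℕ using ()
open import Data.Product.Base using (_×_; _,_; ∃; proj₂)
open import Data.Product.Properties using (≡-dec)
open import Data.Rational.Base as ℚ using (ℚ; 0ℚ; 1ℚ)
open import Data.Sum.Base using (_⊎_; inj₁; inj₂)
open import Function.Base using (_∘_)
open import Function.Bundles using (_⇔_)
open import Level using (0ℓ)
open import Relation.Binary.Construct.Closure.ReflexiveTransitive using (Star; fold)
open import Relation.Binary.Construct.Closure.Symmetric using (SymClosure; fwd; bwd; symmetric)
open import Relation.Binary.Core using (Rel; _⇒_)
open import Relation.Binary.Definitions using (Decidable; DecidableEquality; Symmetric)
open import Relation.Binary.PropositionalEquality.Core using (_≡_; _≢_)
open import Relation.Nullary.Decidable using (map′; does; _×-dec_; _⊎-dec_; ¬?)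
open import Relation.Nullary.Negation using (¬_)
open import Relation.Unary using (Pred)

record FiniteGraph : Set₁ where
  field
    V        : Set
    _≟_      : DecidableEquality V
    vertices : List V
    complete : ∀ v → v ∈ vertices
    unique   : Unique vertices
    Adj      : Rel V 0ℓ
    adj?     : Decidable Adj
    adj-sym  : Symmetric Adj

  deg : V → ℕ
  deg v = length (filter (adj? v) vertices)

-- The vertex (i , j) lies at position i of the cycle and j of the path.
CylinderVertex : ℕ → ℕ → Set
CylinderVertex n m = Fin n × Fin m

data CylinderEdge {n m : ℕ} : Rel (CylinderVertex n m) 0ℓ where
  around : ∀ {i i′ j} → toℕ i′ ≡ _%_ (suc (toℕ i)) n {{nonZeroIndex i}} →
           CylinderEdge (i , j) (i′ , j)
  along  : ∀ {i j j′} → toℕ j′ ≡ suc (toℕ j) →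
           CylinderEdge (i , j) (i , j′)

cylinderEdge? : ∀ {n m} → Decidable (CylinderEdge {n} {m})
cylinderEdge? {n} (i , j) (i′ , j′) = map′ to from
  ((toℕ i′ ℕ.≟ _%_ (suc (toℕ i)) n {{nonZeroIndex i}} ×-dec j Fin.≟ j′)
    ⊎-dec (toℕ j′ ℕ.≟ suc (toℕ j) ×-dec i Fin.≟ i′))
  where
  open _≡_
  Flat : Set
  Flat = (toℕ i′ ≡ _%_ (suc (toℕ i)) n {{nonZeroIndex i}} × j ≡ j′)
       ⊎ (toℕ j′ ≡ suc (toℕ j) × i ≡ i′)
  to : Flat → CylinderEdge (i , j) (i′ , j′)
  to (inj₁ (e , refl)) = around e
  to (inj₂ (e , refl)) = along e
  from : CylinderEdge (i , j) (i′ , j′) → Flat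
  from (around e) = inj₁ (e , refl)
  from (along e)  = inj₂ (e , refl)

cylinder : ℕ → ℕ → FiniteGraph
cylinder n m = record
  { V        = CylinderVertex n m
  ; _≟_      = ≡-dec Fin._≟_ Fin._≟_
  ; vertices = cartesianProduct (allFin n) (allFin m)
  ; complete = λ (i , j) → ∈-cartesianProduct⁺ (∈-allFin i) (∈-allFin j)
  ; unique   = cartesianProduct⁺ (allFin⁺ n) (allFin⁺ m)
  ; Adj      = SymClosure CylinderEdge
  ; adj?     = λ u v → map′ (λ { (inj₁ e) → fwd e ; (inj₂ e) → bwd e })
                            (λ { (fwd e) → inj₁ e ; (bwd e) → inj₂ e })
                            (cylinderEdge? u v ⊎-dec cylinderEdge? v u)
  ; adj-sym  = symmetric CylinderEdge
  }

Ring : ∀ {n m} → ℕ → Pred (CylinderVertex n m) 0ℓ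
Ring k v = toℕ (proj₂ v) ≡ k

OppositeBoundaries : ∀ {n m} → Rel (CylinderVertex n m) 0ℓ
OppositeBoundaries {n} {m} u v =
  (Ring 0 u × Ring (m ∸ 1) v) ⊎ (Ring (m ∸ 1) u × Ring 0 v)

module _ {V : Set} where

  record Subgraph : Set where
    field
      verts : List V
      edges : List (V × V)

  open Subgraph public

  -- Edges are undirected, although each is stored with one orientation.
  Joined : Subgraph → Rel V 0ℓ
  Joined T = SymClosure (λ u v → (u , v) ∈ edges T)

  singleton : V → Subgraph
  singleton r = record { verts = r ∷ [] ; edges = [] }

  addPath : Subgraph → List V → Subgraph
  addPath T p = record
    { verts = p ++ verts T
    ; edges = zip p (drop 1 p) ++ edges T
    }

  IsSimplePath : Rel V 0ℓ → Pred (List V) 0ℓ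
  IsSimplePath E p = Unique p × Linked E p

  IsCycle : Rel V 0ℓ → V → Pred (List V) 0ℓ
  IsCycle E u p = 2 ≤ length p × Unique (u ∷ p) × Linked E (u ∷ p ∷ʳ u)

  ∣_∣ : ∀ {E : Rel V 0ℓ} {u v} → Star E u v → ℕ
  ∣_∣ = fold (λ _ _ → ℕ) (λ _ k → suc k) 0

  IsDistance : Rel V 0ℓ → V → V → ℕ → Set
  IsDistance E u v d =
    (∃ λ (w : Star E u v) → ∣ w ∣ ≡ d) × (∀ (w : Star E u v) → d ≤ ∣ w ∣)

  Outside : Rel V 0ℓ → List V → Rel V 0ℓ
  Outside E L u v = E u v × u ∉ L × v ∉ L

  -- For b ∉ L, the component containing b once the vertices of L are deleted.
  Component : Rel V 0ℓ → List V → V → Pred V 0ℓ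
  Component E L b = Star (Outside E L) b

  IsAttachment : Rel V 0ℓ → List V → Pred V 0ℓ → Pred V 0ℓ
  IsAttachment E L B a = a ∈ L × (∃ λ v → B v × E v a)

  IsBranchLength : Rel V 0ℓ → Pred V 0ℓ → V → ℕ → Set
  IsBranchLength E B a k =
      (∃ λ v → B v × IsDistance E v a k)
    × (∀ v d → B v → IsDistance E v a d → d ≤ k)

  HasBranchOfLengthAtLeast : Subgraph → List V → ℕ → Set
  HasBranchOfLengthAtLeast T L l =
    ∃ λ b → b ∉ L ×
    (∃ λ a → IsAttachment E L (Component E L b) a ×
    (∃ λ k → IsBranchLength E (Component E L b) a k × l ≤ k))
    where E = Joined T

module _ (G : FiniteGraph) where

  open FiniteGraph G
  open DecMembership _≟_ using (_∈?_)

  record IsSpanningTree (T : Subgraph {V}) : Set where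
    field
      spanning  : ∀ v → v ∈ verts T
      inside    : Joined T ⇒ Adj
      connected : ∀ u v → Star (Joined T) u v
      acyclic   : ∀ u p → ¬ IsCycle (Joined T) u p

  -- The current simple path p is stored with its most recent vertex first; a
  -- visit to a vertex v of p deletes everything more recent than v.
  extend : List V → V → List V
  extend p v = if does (v ∈? p) then dropWhile (λ u → ¬? (u ≟ v)) p else v ∷ p

  loopErase : List V → List V
  loopErase w = reverse (foldl extend [] w)

  data HittingWalk (S : Pred V 0ℓ) : V → List V → Set where
    hit  : ∀ {t} → S t → HittingWalk S t (t ∷ [])
    step : ∀ {s u w} → ¬ S s → Adj s u → HittingWalk S u w →
           HittingWalk S s (s ∷ w)

  IsOrdering : V → Pred (List V) 0ℓ
  IsOrdering r o = Unique o × (∀ v → v ∈ o ⇔ v ≢ r)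

  -- A run of Wilson's algorithm is recorded as its successive random walks.
  Run : Set
  Run = List (List V)

  grow : Subgraph → List V → Subgraph
  grow T w = addPath T (loopErase w)

  data Completes (T : Subgraph) : List V → Run → Set where
    done : Completes T [] []
    skip : ∀ {v o ω} → v ∈ verts T → Completes T o ω → Completes T (v ∷ o) ω
    walk : ∀ {v o w ω} → v ∉ verts T → HittingWalk (_∈ verts T) v w →
           Completes (grow T w) o ω → Completes T (v ∷ o) (w ∷ ω)

  IsRun : V → List V → Pred Run 0ℓ
  IsRun r = Completes (singleton r)

  finalTree : V → Run → Subgraph
  finalTree r = foldl grow (singleton r)

  firstPath : Run → List V
  firstPath []      = []
  firstPath (w ∷ _) = loopErase w

  -- The value at 0 is never used: a walk only leaves vertices with a neighbour.
  reciprocal : ℕ → ℚ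
  reciprocal zero    = 0ℚ
  reciprocal (suc k) = + 1 ℚ./ suc k

  walkProbability : List V → ℚ
  walkProbability (u ∷ w@(_ ∷ _)) = reciprocal (deg u) ℚ.* walkProbability w
  walkProbability _               = 1ℚ

  runProbability : Run → ℚ
  runProbability = foldr ℚ._*_ 1ℚ ∘ map walkProbability

  -- The runs form a countable set, and the probability of an event is the sum of
  -- the probabilities of the runs in it.  Since the terms are nonnegative, this
  -- sum is the supremum of its finite partial sums, so it is at most b exactly
  -- when every finite partial sum is.
  ProbabilityAtMost : V → List V → Pred Run 0ℓ → ℚ → Set
  ProbabilityAtMost r o A b =
    ∀ (ωs : List Run) → Unique ωs → All (λ ω → IsRun r o ω × A ω) ωs →
    foldr ℚ._+_ 0ℚ (map runProbability ωs) ℚ.≤ b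

record IsTrunk {n m : ℕ} (T : Subgraph {CylinderVertex n m})
               (L : List (CylinderVertex n m)) : Set where
  field
    spanningTree : IsSpanningTree (cylinder n m) T
    simplePath   : IsSimplePath (Joined T) L
    meetsRings   : ∀ k → k < m → Any (Ring k) L

fromℕ : ℕ → ℚ
fromℕ k = + k ℚ./ 1

infixr 8 _^ℚ_

_^ℚ_ : ℚ → ℕ → ℚ
_^ℚ_ = _^_ ℚ.+-*-rawSemiring

{-# OPTIONS --safe #-}

-- The first path L joins the two boundary rings, and levels change by at most one
-- along an edge, so L meets every ring.  For the tail bound, record for every
-- vertex the stack of successive exits made by the walks.  A run is determined by
-- its ordering and its stacks, and its probability depends on the stacks only.
-- Using up the stacks is a sequence of moves, each of which pops a cycle outside
-- the tree or attaches a vertex to the tree; by induction on such a sequence, the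
-- walk from any vertex v to L read off from the same stacks leaves stacks that can
-- still be used up to build the same tree.  Hence the runs in which v has distance
-- at least l from L inject, with their probabilities, into the runs that continue
-- from v after L is built, and there the walk from v takes at least l steps before
-- hitting L.
--
-- Since L meets every ring, every vertex is within distance n of L, and degrees are
-- at most 4.  With q = 1/4 and k the distance to L inside the ring, the potential
-- 2 - q^k contracts on average by θ = 1 - q^(n+1) at every step, so that walk takes
-- at least l steps with probability at most 2 θ^l.  Summing over the n m vertices,
-- and n ≤ 2 (n - 1), gives the claim with C = 4.

module Submission where

open import Defs
open import Data.Fin.Base using (Fin; toℕ; fromℕ<)
import Data.Fin.Properties as Fin
import Data.Integer.Base as ℤ
import Data.Integer.Properties as ℤ
open import Data.List.Base using (List; []; _∷_; _++_; zip; drop; map; concat; foldl; reverse; length; dropWhile; foldr; initLast; _∷ʳ′_; deduplicate; filter; allFin; cartesianProduct)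
import Data.List.Membership.DecPropositional as DecMembership
open import Data.List.Membership.Propositional using (_∈_; _∉_)
open import Data.List.Membership.Propositional.Properties using (∈-∃++; ∈-++⁺ˡ; ∈-++⁺ʳ; ∈-++⁻; ∈-map⁺; ∈-deduplicate⁺; ∈-deduplicate⁻; ∈-filter⁺; ∈-filter⁻)
open import Data.List.Properties using (++-assoc; ++-identityʳ; ∷-injective; reverse-++; reverse-involutive; length-++; unfold-reverse; length-map; length-tabulate; ≡-dec)
open import Data.List.Relation.Binary.Permutation.Propositional using (_↭_; ↭-refl; ↭-sym; ↭⇒↭ₛ)
open import Data.List.Relation.Binary.Permutation.Propositional.Properties using (∈-resp-↭; All-resp-↭; ++-comm)
import Data.List.Relation.Binary.Permutation.Setoid.Properties as Permutation
open import Data.List.Relation.Binary.Subset.Propositional using (_⊆_)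
open import Data.List.Relation.Unary.All as All using (All; []; _∷_)
import Data.List.Relation.Unary.All.Properties as All
open import Data.List.Relation.Unary.AllPairs as AllPairs using ([]; _∷_)
import Data.List.Relation.Unary.AllPairs.Properties as AllPairs
open import Data.List.Relation.Unary.Any as Any using (here; there; Any)
open import Data.List.Relation.Unary.Any.Properties as Any using (reverse⁻; reverse⁺)
open import Data.List.Relation.Unary.Linked using (Linked; []; [-]; _∷_)
import Data.List.Relation.Unary.Unique.DecPropositional.Properties as Unique
open import Data.List.Relation.Unary.Unique.Propositional using (Unique)
import Data.List.Relation.Unary.Unique.Propositional.Properties as Uniq
open import Data.Nat.Base as ℕ using (ℕ; zero; suc; s≤s; z≤n; _⊔_)
open import Data.Nat.DivMod using (_%_; m<n⇒m%n≡m; n%n≡0)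
import Data.Nat.Properties as ℕ
open import Data.Product.Base using (_×_; _,_; ∃; proj₁; proj₂; uncurry)
open import Data.Rational.Base as ℚ using (ℚ; 0ℚ; 1ℚ; _*_; _+_; _≤_; nonNegative; _-_; toℚᵘ)
import Data.Rational.Properties as ℚ
open import Data.Rational.Solver using (module +-*-Solver)
open import Data.Rational.Unnormalised.Base as ℚᵘ using (mkℚᵘ; *≡*)
import Data.Rational.Unnormalised.Properties as ℚᵘ
open import Data.Sum.Base using (_⊎_; inj₁; inj₂)
open import Data.Unit.Base using (⊤; tt)
open import Function.Base using (_∘_; id; const)
open import Function.Bundles using (Equivalence)
open import Level using (0ℓ)
open import Relation.Binary.Construct.Closure.ReflexiveTransitive as Star using (Star; ε; _◅_; _◅◅_)
import Relation.Binary.Construct.Closure.ReflexiveTransitive.Properties as Star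
open import Relation.Binary.Construct.Closure.Symmetric using (SymClosure; fwd; bwd; symmetric)
open import Relation.Binary.Core using (Rel)
open import Relation.Binary.Definitions using (DecidableEquality; tri<; tri≈; tri>)
open import Relation.Binary.PropositionalEquality using (_≡_; _≢_; refl; sym; trans; cong; cong₂; subst; ≢-sym; module ≡-Reasoning; setoid)
open import Relation.Nullary using (¬_; yes; no; contradiction)
open import Relation.Nullary.Decidable using (¬?; from-yes)
open import Relation.Unary using (Pred; Decidable; _∪_)

-- Steps of walks and trace equivalence

module _ {V : Set} where

  steps : List V → List (V × V)
  steps w = zip w (drop 1 w)

  steps-++ : ∀ a u b → steps (a ++ u ∷ b) ≡ steps (a ++ u ∷ []) ++ steps (u ∷ b)
  steps-++ []          u b = refl
  steps-++ (x ∷ [])    u b = refl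
  steps-++ (x ∷ y ∷ a) u b = cong ((x , y) ∷_) (steps-++ (y ∷ a) u b)

  -- The last vertex `t` is only entered, never left, so nothing is asked of it.
  All-sources : ∀ {P : V → Set} a {t} → All P a → All (P ∘ proj₁) (steps (a ++ t ∷ []))
  All-sources []          []       = []
  All-sources (x ∷ [])    (p ∷ ps) = p ∷ []
  All-sources (x ∷ y ∷ a) (p ∷ ps) = p ∷ All-sources (y ∷ a) ps

  -- Trace equivalence: two sequences of steps are equivalent when every vertex
  -- is left in the same way the same number of times, in the same order.
  infix 4 _~_
  data _~_ : List (V × V) → List (V × V) → Set where
    ~-refl  : ∀ {xs} → xs ~ xs
    prep    : ∀ s {xs ys} → xs ~ ys → s ∷ xs ~ s ∷ ys
    swap    : ∀ {s t xs} → proj₁ s ≢ proj₁ t → s ∷ t ∷ xs ~ t ∷ s ∷ xs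
    ~-trans : ∀ {xs ys zs} → xs ~ ys → ys ~ zs → xs ~ zs

  ~-sym : ∀ {xs ys} → xs ~ ys → ys ~ xs
  ~-sym ~-refl        = ~-refl
  ~-sym (prep s p)  = prep s (~-sym p)
  ~-sym (swap p)    = swap (≢-sym p)
  ~-sym (~-trans p q) = ~-trans (~-sym q) (~-sym p)

  ~-reflexive : ∀ {xs ys} → xs ≡ ys → xs ~ ys
  ~-reflexive refl = ~-refl

  ++⁺ˡ : ∀ xs {ys zs} → ys ~ zs → xs ++ ys ~ xs ++ zs
  ++⁺ˡ []       p = p
  ++⁺ˡ (x ∷ xs) p = prep x (++⁺ˡ xs p)

  ++⁺ʳ : ∀ {xs ys} zs → xs ~ ys → xs ++ zs ~ ys ++ zs
  ++⁺ʳ zs ~-refl        = ~-refl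
  ++⁺ʳ zs (prep s p)  = prep s (++⁺ʳ zs p)
  ++⁺ʳ zs (swap p)    = swap p
  ++⁺ʳ zs (~-trans p q) = ~-trans (++⁺ʳ zs p) (++⁺ʳ zs q)

  Apart : List (V × V) → List (V × V) → Set
  Apart xs ys = All (λ s → All (λ t → proj₁ s ≢ proj₁ t) ys) xs

  pass : ∀ {s} ys {zs} → All (λ t → proj₁ s ≢ proj₁ t) ys → s ∷ ys ++ zs ~ ys ++ s ∷ zs
  pass []       []       = ~-refl
  pass (y ∷ ys) (p ∷ ps) = ~-trans (swap p) (prep y (pass ys ps))

  -- Lets a cycle be popped before or after a piece of walk that leaves none of its vertices.
  commute : ∀ xs ys {zs} → Apart xs ys → xs ++ ys ++ zs ~ ys ++ xs ++ zs
  commute []       ys []       = ~-refl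
  commute (x ∷ xs) ys (p ∷ ps) = ~-trans (prep x (commute xs ys ps)) (pass ys p)

  apart-steps : ∀ a b {s t} → All (_∉ b) a → Apart (steps (a ++ s ∷ [])) (steps (b ++ t ∷ []))
  apart-steps a b a∉b = All-sources a (All.map
    (λ u∉b → All-sources b (All.tabulate λ v∈b u≡v → u∉b (subst (_∈ b) (sym u≡v) v∈b))) a∉b)

module _ {V : Set} (_≟_ : DecidableEquality V) where

  exits : V → List (V × V) → List V
  exits z []             = []
  exits z ((u , y) ∷ xs) with z ≟ u
  ... | yes _ = y ∷ exits z xs
  ... | no  _ = exits z xs

  exits-here : ∀ z {y xs} → exits z ((z , y) ∷ xs) ≡ y ∷ exits z xs
  exits-here z with z ≟ z
  ... | yes _  = refl
  ... | no z≢z = contradiction refl z≢z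

  exits-there : ∀ {z u y xs} → z ≢ u → exits z ((u , y) ∷ xs) ≡ exits z xs
  exits-there {z} {u} z≢u with z ≟ u
  ... | yes z≡u = contradiction z≡u z≢u
  ... | no  _   = refl

  -- Only steps with different sources are swapped, so the order of the exits from any one vertex is
  -- preserved.
  exits-~ : ∀ {xs ys} → xs ~ ys → ∀ z → exits z xs ≡ exits z ys
  exits-~ ~-refl              z = refl
  exits-~ (prep (u , y) p)    z with z ≟ u
  ... | yes _ = cong (y ∷_) (exits-~ p z)
  ... | no  _ = exits-~ p z
  exits-~ (swap {u , y} {v , x} {xs} u≢v) z with z ≟ u
  ... | no z≢u with z ≟ v
  ...   | yes refl = cong (x ∷_) (sym (exits-there z≢u))
  ...   | no  _    = sym (exits-there z≢u)
  exits-~ (swap {u , y} {v , x} {xs} u≢v) z | yes refl =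
    trans (cong (y ∷_) (exits-there u≢v)) (sym (trans (exits-there u≢v) (exits-here z)))
  exits-~ (~-trans p q)       z = trans (exits-~ p z) (exits-~ q z)

-- Loop erasure

module _ {V : Set} where

  unique-split : ∀ a {v : V} {b} → Unique (a ++ v ∷ b) →
                 v ∉ b × Unique (a ++ v ∷ []) × All (_∉ v ∷ b) a
  unique-split []      (p ∷ _) = (λ v∈b → All.lookup p v∈b refl) , [] ∷ [] , []
  unique-split (x ∷ a) {v} {b} (p ∷ u) =
    let v∉b , u′ , a∉ = unique-split a u
        x≢a , x≢vb = All.++⁻ a p
    in v∉b , All.++⁺ x≢a (All.head x≢vb ∷ []) ∷ u′ , (λ x∈ → All.lookup x≢vb x∈ refl) ∷ a∉

  unique-++⁻ˡ : ∀ (a : List V) {b} → Unique (a ++ b) → Unique a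
  unique-++⁻ˡ []      _       = []
  unique-++⁻ˡ (x ∷ a) (p ∷ u) = All.++⁻ˡ a p ∷ unique-++⁻ˡ a u

  unique-++⁻ʳ : ∀ (a : List V) {b} → Unique (a ++ b) → Unique b
  unique-++⁻ʳ []      u       = u
  unique-++⁻ʳ (x ∷ a) (_ ∷ u) = unique-++⁻ʳ a u

  unique-snoc : ∀ {a} {v : V} → Unique a → v ∉ a → Unique (a ++ v ∷ [])
  unique-snoc u v∉a = AllPairs.++⁺ u ([] ∷ []) (All.tabulate λ x∈a → (λ { refl → v∉a x∈a }) ∷ [])

  -- Unlike for extend, the path is in chronological order here.
  data Extend : List V → V → List V → Set where
    fresh : ∀ {P v} → v ∉ P → Extend P v (P ++ v ∷ [])
    cut   : ∀ a {v b} → Extend (a ++ v ∷ b) v (a ++ v ∷ [])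

  infixr 5 _∷_
  -- Loop erasure as a relation, started from an arbitrary path, so that a proof can split on
  -- whether each new vertex extends the path or closes a loop.
  data Erase : List V → List V → List V → Set where
    []  : ∀ {P} → Erase P [] P
    _∷_ : ∀ {P v P′ w Q} → Extend P v P′ → Erase P′ w Q → Erase P (v ∷ w) Q

  extend-unique : ∀ {P v P′} → Unique P → Extend P v P′ → Unique P′
  extend-unique u (fresh v∉P) = unique-snoc u v∉P
  extend-unique u (cut a)     = proj₁ (proj₂ (unique-split a u))

  erase-unique : ∀ {P w Q} → Unique P → Erase P w Q → Unique Q
  erase-unique u []      = u
  erase-unique u (x ∷ e) = erase-unique (extend-unique u x) e

  extend-⊆ : ∀ {P v P′} → Extend P v P′ → ∀ {z} → z ∈ P′ → z ∈ P ⊎ z ≡ v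
  extend-⊆ {P} (fresh _) z∈ with ∈-++⁻ P z∈
  ... | inj₁ z∈P         = inj₁ z∈P
  ... | inj₂ (here refl) = inj₂ refl
  extend-⊆ (cut a) z∈ with ∈-++⁻ a z∈
  ... | inj₁ z∈a         = inj₁ (∈-++⁺ˡ z∈a)
  ... | inj₂ (here refl) = inj₂ refl

  erase-⊆ : ∀ {P w Q} → Erase P w Q → ∀ {z} → z ∈ Q → z ∈ P ⊎ z ∈ w
  erase-⊆ []      z∈ = inj₁ z∈
  erase-⊆ (x ∷ e) z∈ with erase-⊆ e z∈
  ... | inj₂ z∈w = inj₂ (there z∈w)
  ... | inj₁ z∈P′ with extend-⊆ x z∈P′
  ...   | inj₁ z∈P  = inj₁ z∈P
  ...   | inj₂ refl = inj₂ (here refl)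

  extend-length : ∀ {P v P′} → Extend P v P′ → length P′ ℕ.≤ suc (length P)
  extend-length {P} (fresh _) = ℕ.≤-reflexive (trans (length-++ P) (ℕ.+-comm (length P) 1))
  extend-length (cut a {v} {b}) = begin
    length (a ++ v ∷ [])         ≡⟨ length-++ a ⟩
    length a ℕ.+ 1                 ≡⟨ ℕ.+-comm (length a) 1 ⟩
    suc (length a)               ≤⟨ s≤s (ℕ.m≤m+n (length a) (suc (length b))) ⟩
    suc (length a ℕ.+ suc (length b)) ≡⟨ cong suc (length-++ a) ⟨
    suc (length (a ++ v ∷ b))    ∎
    where open ℕ.≤-Reasoning

  erase-length : ∀ {P w Q} → Erase P w Q → length Q ℕ.≤ length w ℕ.+ length P
  erase-length []      = ℕ.≤-refl
  erase-length {P} {_ ∷ w} (x ∷ e) = ℕ.≤-trans (erase-length e)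
    (ℕ.≤-trans (ℕ.+-monoʳ-≤ (length w) (extend-length x))
               (ℕ.≤-reflexive (ℕ.+-suc (length w) (length P))))

  erase-++ : ∀ {P w Q w′ Q′} → Erase P w Q → Erase Q w′ Q′ → Erase P (w ++ w′) Q′
  erase-++ []      f = f
  erase-++ (x ∷ e) f = x ∷ erase-++ e f

  erase-++⁻ : ∀ {P} w {w′ Q′} → Erase P (w ++ w′) Q′ → ∃ λ Q → Erase P w Q × Erase Q w′ Q′
  erase-++⁻ []      e       = _ , [] , e
  erase-++⁻ (_ ∷ w) (x ∷ e) = let _ , e₁ , e₂ = erase-++⁻ w e in _ , x ∷ e₁ , e₂

  -- A cut keeps the revisited vertex itself, so the start of the path survives even when it is the
  -- vertex revisited.
  extend-head : ∀ {z P v P′} → Extend (z ∷ P) v P′ → ∃ λ R → P′ ≡ z ∷ R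
  extend-head {z} {P} {v} x = go x refl
    where
    go : ∀ {S P′} → Extend S v P′ → S ≡ z ∷ P → ∃ λ R → P′ ≡ z ∷ R
    go (fresh _)     refl = _ , refl
    go (cut [])      refl = _ , refl
    go (cut (_ ∷ _)) refl = _ , refl

  erase-head : ∀ {z P w Q} → Erase (z ∷ P) w Q → ∃ λ R → Q ≡ z ∷ R
  erase-head []      = _ , refl
  erase-head (x ∷ e) with extend-head x
  ... | _ , refl = erase-head e

  extend-last : ∀ {P v P′} → Extend P v P′ → ∃ λ R → P′ ≡ R ++ v ∷ []
  extend-last (fresh _) = _ , refl
  extend-last (cut _)   = _ , refl

  erase-last : ∀ {P} W {t Q} → Erase P (W ++ t ∷ []) Q → ∃ λ R → Q ≡ R ++ t ∷ []
  erase-last W e with erase-++⁻ W e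
  ... | _ , _ , x ∷ [] = extend-last x

  erase-fresh : ∀ P c → Unique c → All (_∉ P) c → Erase P c (P ++ c)
  erase-fresh P []      []      []       = subst (Erase P []) (sym (++-identityʳ P)) []
  erase-fresh P (v ∷ c) (p ∷ u) (v∉ ∷ c∉) =
    fresh v∉ ∷ subst (Erase (P ++ v ∷ []) c) (++-assoc P (v ∷ []) c)
      (erase-fresh (P ++ v ∷ []) c u (All.zipWith (λ (v≢x , x∉P) x∈ → [ x∉P , v≢x ]′ x∈) (p , c∉)))
    where
    [_,_]′ : ∀ {x} → x ∉ P → v ≢ x → x ∉ P ++ v ∷ []
    [ x∉P , v≢x ]′ x∈ with ∈-++⁻ P x∈
    ... | inj₁ x∈P         = x∉P x∈P
    ... | inj₂ (here refl) = v≢x refl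

  -- A detour around the cycle `z ∷ c` is invisible to loop erasure: the cycle avoids the path `P`
  -- kept so far, so it is appended in full and then deleted when the walk is back at `z`.
  erase-loop : ∀ P z c {w Q} → Unique (z ∷ c) → All (_∉ P) (z ∷ c) →
               Erase P (z ∷ w) Q → Erase P (z ∷ c ++ z ∷ w) Q
  erase-loop P z c {w} {Q} u c∉ (x ∷ e) = go x e refl
    where
    go : ∀ {S R} → Extend S z R → Erase R w Q → S ≡ P → Erase P (z ∷ c ++ z ∷ w) Q
    go (fresh _) e refl = erase-++ (erase-fresh P (z ∷ c) u c∉) (cut P ∷ e)
    go (cut a)   e refl = contradiction (∈-++⁺ʳ a (here refl)) (All.head c∉)

module _ (G : FiniteGraph) where

  open FiniteGraph G
  open DecMembership _≟_ using (_∈?_)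

  dropWhile-≢ : ∀ {v} xs {ys} → v ∉ xs →
                dropWhile (λ u → ¬? (u ≟ v)) (xs ++ v ∷ ys) ≡ v ∷ ys
  dropWhile-≢ {v} [] v∉ with v ≟ v
  ... | yes _  = refl
  ... | no v≢v = contradiction refl v≢v
  dropWhile-≢ {v} (x ∷ xs) v∉ with x ≟ v
  ... | yes refl = contradiction (here refl) v∉
  ... | no  _    = dropWhile-≢ xs (v∉ ∘ there)

  -- Uniqueness makes the occurrence of `v` at which `dropWhile` stops the one at which `cut` splits
  -- the path.
  extend-spec : ∀ {P v P′} → Unique P → Extend P v P′ → extend G (reverse P) v ≡ reverse P′
  extend-spec {P} {v} u (fresh v∉P) with v ∈? reverse P
  ... | yes v∈ = contradiction (reverse⁻ v∈) v∉P
  ... | no  _  = sym (reverse-++ P (v ∷ []))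
  extend-spec {v = v} u (cut a {b = b}) with v ∈? reverse (a ++ v ∷ b)
  ... | no v∉ = contradiction (reverse⁺ (∈-++⁺ʳ a (here refl))) v∉
  ... | yes _ = begin
    dropWhile ≢v? (reverse (a ++ v ∷ b))
      ≡⟨ cong (dropWhile ≢v?) (reverse-++ a (v ∷ b)) ⟩
    dropWhile ≢v? (reverse (v ∷ b) ++ reverse a)
      ≡⟨ cong (λ c → dropWhile ≢v? (c ++ reverse a)) (unfold-reverse v b) ⟩
    dropWhile ≢v? ((reverse b ++ v ∷ []) ++ reverse a)
      ≡⟨ cong (dropWhile ≢v?) (++-assoc (reverse b) (v ∷ []) (reverse a)) ⟩
    dropWhile ≢v? (reverse b ++ v ∷ reverse a)
      ≡⟨ dropWhile-≢ (reverse b) (proj₁ (unique-split a u) ∘ reverse⁻) ⟩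
    v ∷ reverse a
      ≡⟨ reverse-++ a (v ∷ []) ⟨
    reverse (a ++ v ∷ []) ∎
    where
    open ≡-Reasoning
    ≢v? = λ x → ¬? (x ≟ v)

  extend-total : ∀ P v → ∃ λ P′ → Extend P v P′
  extend-total P v with v ∈? P
  ... | no v∉P  = _ , fresh v∉P
  ... | yes v∈P with ∈-∃++ v∈P
  ...   | a , b , refl = _ , cut a

  erase-spec : ∀ {P w Q} → Unique P → Erase P w Q → foldl (extend G) (reverse P) w ≡ reverse Q
  erase-spec u []      = refl
  erase-spec {w = v ∷ w} u (x ∷ e) =
    trans (cong (λ p → foldl (extend G) p w) (extend-spec u x)) (erase-spec (extend-unique u x) e)

  erase-total : ∀ P w → ∃ λ Q → Erase P w Q
  erase-total P []      = _ , []
  erase-total P (v ∷ w) =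
    let P′ , x = extend-total P v ; _ , e = erase-total P′ w in _ , x ∷ e

  Erase⇒loopErase : ∀ {w Q} → Erase [] w Q → loopErase G w ≡ Q
  Erase⇒loopErase {w} {Q} e = trans (cong reverse (erase-spec [] e)) (reverse-involutive Q)

  loopErase-Erase : ∀ w → Erase [] w (loopErase G w)
  loopErase-Erase w = let _ , e = erase-total [] w in
    subst (Erase [] w) (sym (Erase⇒loopErase e)) e

-- Popping cycles

module _ {V : Set} where

  -- Phrased through the list of steps, so that `steps-++` splits it together with the walk.
  Along : Rel V 0ℓ → List V → Set
  Along R w = All (uncurry R) (steps w)

  along-++⁻ : ∀ {R} a u b → Along R (a ++ u ∷ b) → Along R (a ++ u ∷ []) × Along R (u ∷ b)
  along-++⁻ a u b rs = All.++⁻ (steps (a ++ u ∷ [])) (subst (All _) (steps-++ a u b) rs)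

  along-++⁺ : ∀ {R} a u b → Along R (a ++ u ∷ []) → Along R (u ∷ b) → Along R (a ++ u ∷ b)
  along-++⁺ a u b rs ss = subst (All _) (sym (steps-++ a u b)) (All.++⁺ rs ss)

  sources-∈ : ∀ w → All (λ (s : V × V) → proj₁ s ∈ w) (steps w)
  sources-∈ []          = []
  sources-∈ (x ∷ [])    = []
  sources-∈ (x ∷ y ∷ w) = here refl ∷ All.map there (sources-∈ (y ∷ w))

  -- A popped cycle has no distinguished base point: the arcs from `z` to `x` and from `x` to `z`
  -- leave disjoint sets of vertices, so exchanging them is a trace equivalence.
  rotate : ∀ {R} {z : V} {c x} → Unique (z ∷ c) → Along R (z ∷ c ++ z ∷ []) → x ∈ z ∷ c →
           ∃ λ d → (x ∷ d) ↭ (z ∷ c) × Along R (x ∷ d ++ x ∷ []) ×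
                   steps (z ∷ c ++ z ∷ []) ~ steps (x ∷ d ++ x ∷ [])
  rotate {c = c} u rs (here refl) = c , ↭-refl , rs , ~-refl
  rotate {R} {z} {c} {x} u rs (there x∈c) with ∈-∃++ x∈c
  ... | a , b , refl = b ++ z ∷ a , ++-comm (x ∷ b) (z ∷ a) , turned , eqv
    where
    fore = steps (z ∷ a ++ x ∷ [])
    back = steps (x ∷ b ++ z ∷ [])
    split : steps (z ∷ (a ++ x ∷ b) ++ z ∷ []) ≡ fore ++ back
    split = trans (cong (λ l → steps (z ∷ l)) (++-assoc a (x ∷ b) (z ∷ []))) (steps-++ (z ∷ a) x (b ++ z ∷ []))
    join : steps (x ∷ (b ++ z ∷ a) ++ x ∷ []) ≡ back ++ fore
    join = trans (cong (λ l → steps (x ∷ l)) (++-assoc b (z ∷ a) (x ∷ []))) (steps-++ (x ∷ b) z (a ++ x ∷ []))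
    turned : Along R (x ∷ (b ++ z ∷ a) ++ x ∷ [])
    turned with All.++⁻ fore (subst (All _) split rs)
    ... | fs , bs = subst (All _) (sym join) (All.++⁺ bs fs)
    eqv : steps (z ∷ (a ++ x ∷ b) ++ z ∷ []) ~ steps (x ∷ (b ++ z ∷ a) ++ x ∷ [])
    eqv = ~-trans (~-reflexive (trans split (cong (fore ++_) (sym (++-identityʳ back)))))
         (~-trans (commute fore back (apart-steps (z ∷ a) (x ∷ b) (proj₂ (proj₂ (unique-split (z ∷ a) u)))))
                  (~-reflexive (trans (cong (back ++_) (++-identityʳ fore)) (sym join))))

  Unique-resp-↭ : ∀ {xs ys : List V} → xs ↭ ys → Unique xs → Unique ys
  Unique-resp-↭ p = Permutation.Unique-resp-↭ (setoid V) (↭⇒↭ₛ p)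

module _ (G : FiniteGraph) where

  open FiniteGraph G
  open DecMembership _≟_ using (_∈?_)

  -- Good E T Σ: the stacks Σ can be used up by settling vertices onto the tree
  -- T, along edges in E, and by popping simple cycles, in some order, until the
  -- tree spans the graph.
  data Good (E : Rel V 0ℓ) : List V → List (V × V) → Set where
    done   : ∀ {T} → (∀ v → v ∈ T) → Good E T []
    settle : ∀ {T Σ Σ′ u y} → u ∉ T → y ∈ T → Adj u y → E u y →
             Σ ~ (u , y) ∷ Σ′ → Good E (u ∷ T) Σ′ → Good E T Σ
    pop    : ∀ {T Σ Σ′ z c} → Unique (z ∷ c) → All (_∉ T) (z ∷ c) → Along Adj (z ∷ c ++ z ∷ []) →
             Σ ~ steps (z ∷ c ++ z ∷ []) ++ Σ′ → Good E T Σ′ → Good E T Σ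

  ~[]⇒[] : ∀ {A : Set} {xs ys : List (A × A)} → xs ~ ys → ys ≡ [] → xs ≡ []
  ~[]⇒[] ~-refl        e = e
  ~[]⇒[] (~-trans p q) e = ~[]⇒[] p (~[]⇒[] q e)

  good-~ : ∀ {E T Σ Σ′} → Σ ~ Σ′ → Good E T Σ′ → Good E T Σ
  good-~ p (done all) = subst (Good _ _) (sym (~[]⇒[] p refl)) (done all)
  good-~ p (settle a b c d q g) = settle a b c d (~-trans p q) g
  good-~ p (pop a b c q g)      = pop a b c (~-trans p q) g

  -- The tree enters `Good` only through its set of vertices; order and repetitions in the list are
  -- immaterial.
  good-≐ : ∀ {E T T′ Σ} → T ⊆ T′ → T′ ⊆ T → Good E T Σ → Good E T′ Σ
  good-≐ i j (done all) = done (i ∘ all)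
  good-≐ {T = T} {T′} i j (settle {u = u} u∉ y∈ a e p g) = settle (u∉ ∘ j) (i y∈) a e p (good-≐ (cons i) (cons j) g)
    where
    cons : ∀ {A B} → A ⊆ B → (u ∷ A) ⊆ (u ∷ B)
    cons f (here e)  = here e
    cons f (there x) = there (f x)
  good-≐ i j (pop u ∉T a p g) = pop u (All.map (_∘ j) ∉T) a p (good-≐ i j g)

  -- A path has to be attached from its tip backwards, while its steps are listed from its start. As
  -- `p` is left only once on the path, `pass` moves its step behind the others.
  settlePath : ∀ {E T Σ} P {t} → t ∈ T → All (_∉ T) P → Unique P → Along Adj (P ++ t ∷ []) →
               Along E (P ++ t ∷ []) → Good E ((P ++ t ∷ []) ++ T) Σ →
               Good E T (steps (P ++ t ∷ []) ++ Σ)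
  settlePath [] t∈T [] [] _ _ g = good-≐ (λ { (here refl) → t∈T ; (there x) → x }) there g
  settlePath {T = T} {Σ} (p ∷ P) {t} t∈T (p∉T ∷ P∉T) (p≢ ∷ u) as es g = go P refl as es
    where
    p∉P : p ∉ P ++ t ∷ []
    p∉P p∈ with ∈-++⁻ P p∈
    ... | inj₁ p∈P         = All.lookup p≢ p∈P refl
    ... | inj₂ (here refl) = p∉T t∈T
    apart : All (λ s → p ≢ proj₁ s) (steps (P ++ t ∷ []))
    apart = All.map (λ s∈ p≡ → p∉P (subst (_∈ P ++ t ∷ []) (sym p≡) s∈)) (sources-∈ (P ++ t ∷ []))
    settled : ∀ {q} → q ∈ P ++ t ∷ [] → Adj p q → _ → Along Adj (P ++ t ∷ []) → Along _ (P ++ t ∷ []) →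
              Good _ T ((p , q) ∷ steps (P ++ t ∷ []) ++ Σ)
    settled {q} q∈ a e as es = good-~ (pass (steps (P ++ t ∷ [])) apart)
      (settlePath P t∈T P∉T u as es (settle p∉ (∈-++⁺ˡ q∈) a e ~-refl g))
      where
      p∉ : p ∉ (P ++ t ∷ []) ++ T
      p∉ p∈ with ∈-++⁻ (P ++ t ∷ []) p∈
      ... | inj₁ x = p∉P x
      ... | inj₂ x = p∉T x
    go : ∀ P′ → P′ ≡ P → Along Adj (p ∷ P′ ++ t ∷ []) → Along _ (p ∷ P′ ++ t ∷ []) →
         Good _ T (steps (p ∷ P′ ++ t ∷ []) ++ Σ)
    go []       refl (a ∷ as) (e ∷ es) = settled (here refl) a e as es
    go (q ∷ P′) refl (a ∷ as) (e ∷ es) = settled (here refl) a e as es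

  -- Induction along the walk: every loop it closes is popped, and when it hits the tree the
  -- remaining simple path is settled. `S` is the path kept so far, and its last vertex `u` is the
  -- only one that may lie in the tree.
  unwalk : ∀ {E T Σ P u S w Q} → HittingWalk G (_∈ T) u (u ∷ w) → S ≡ P ++ u ∷ [] →
           Unique S → All (_∉ T) P → Along Adj S → Erase S w Q → Along E Q →
           Good E (Q ++ T) Σ → Good E T (steps (P ++ u ∷ w) ++ Σ)
  unwalk {P = P} (hit u∈T) refl uS P∉T as [] es g =
    settlePath P u∈T P∉T (unique-++⁻ˡ P uS) as es g
  unwalk {E} {T} {Σ} {P} {u} {S} {v ∷ w} {Q} (step u∉T a h) S≡ uS P∉T as (x ∷ e) es g = go (head h) x e S≡
    where
    head : ∀ {s x w} → HittingWalk G (_∈ T) s (x ∷ w) → HittingWalk G (_∈ T) x (x ∷ w)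
    head (hit t)      = hit t
    head (step n a h) = step n a h
    head≡ : ∀ {s x w} → HittingWalk G (_∈ T) s (x ∷ w) → s ≡ x
    head≡ (hit t)      = refl
    head≡ (step n a h) = refl
    adj : Adj u v
    adj = subst (Adj u) (head≡ h) a
    S∉T : All (_∉ T) S
    S∉T = subst (All (_∉ T)) (sym S≡) (All.++⁺ P∉T (u∉T ∷ []))
    S++v : Along Adj (S ++ v ∷ [])
    S++v = subst (Along Adj) (trans (sym (++-assoc P (u ∷ []) (v ∷ []))) (cong (_++ v ∷ []) (sym S≡)))
             (along-++⁺ P u (v ∷ []) (subst (Along Adj) S≡ as) (adj ∷ []))
    target : steps (P ++ u ∷ v ∷ w) ≡ steps (S ++ v ∷ w)
    target = cong steps (trans (sym (++-assoc P (u ∷ []) (v ∷ w))) (cong (_++ v ∷ w) (sym S≡)))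
    go : ∀ {P′} → HittingWalk G (_∈ T) v (v ∷ w) → Extend S v P′ → Erase P′ w Q → S ≡ P ++ u ∷ [] →
         Good E T (steps (P ++ u ∷ v ∷ w) ++ Σ)
    go h y@(fresh v∉S) e _ =
      subst (λ xs → Good E T (xs ++ Σ)) (sym target)
        (unwalk h refl (extend-unique uS y) S∉T S++v e es g)
    go h y@(cut c {b = b}) e _ =
      subst (λ xs → Good E T (xs ++ Σ)) (sym target)
        (pop (unique-++⁻ʳ c uS) (All.++⁻ʳ c S∉T)
          (proj₂ (along-++⁻ c v (b ++ v ∷ []) (subst (Along Adj) (++-assoc c (v ∷ b) (v ∷ [])) S++v)))
          eqv
          (unwalk h refl (extend-unique uS y) (All.++⁻ˡ c S∉T) (proj₁ (along-++⁻ c v b as)) e es g))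
      where
      stem = steps (c ++ v ∷ [])
      loop = steps (v ∷ b ++ v ∷ [])
      -- The stem before the loop leaves only vertices off the loop, so the loop can be moved in
      -- front of it and popped first.
      eqv : steps ((c ++ v ∷ b) ++ v ∷ w) ++ Σ ~ loop ++ steps (c ++ v ∷ w) ++ Σ
      eqv = ~-trans (~-reflexive (begin
          steps ((c ++ v ∷ b) ++ v ∷ w) ++ Σ
            ≡⟨ cong (λ l → steps l ++ Σ) (++-assoc c (v ∷ b) (v ∷ w)) ⟩
          steps (c ++ v ∷ b ++ v ∷ w) ++ Σ
            ≡⟨ cong (_++ Σ) (steps-++ c v (b ++ v ∷ w)) ⟩
          (stem ++ steps (v ∷ b ++ v ∷ w)) ++ Σ
            ≡⟨ cong (λ l → (stem ++ l) ++ Σ) (steps-++ (v ∷ b) v w) ⟩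
          (stem ++ loop ++ steps (v ∷ w)) ++ Σ
            ≡⟨ ++-assoc stem (loop ++ steps (v ∷ w)) Σ ⟩
          stem ++ (loop ++ steps (v ∷ w)) ++ Σ
            ≡⟨ cong (stem ++_) (++-assoc loop (steps (v ∷ w)) Σ) ⟩
          stem ++ loop ++ steps (v ∷ w) ++ Σ ∎))
        (~-trans (commute stem loop (apart-steps c (v ∷ b) (proj₂ (proj₂ (unique-split c uS)))))
          (~-reflexive (cong (loop ++_) (begin
            stem ++ steps (v ∷ w) ++ Σ   ≡⟨ ++-assoc stem (steps (v ∷ w)) Σ ⟨
            (stem ++ steps (v ∷ w)) ++ Σ ≡⟨ cong (_++ Σ) (steps-++ c v w) ⟨
            steps (c ++ v ∷ w) ++ Σ      ∎))))
        where open ≡-Reasoning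

-- Reading a walk off from the stacks

module _ (G : FiniteGraph) where

  open FiniteGraph G
  open DecMembership _≟_ using (_∈?_)

  hitting-head : ∀ {S s w} → HittingWalk G S s w → ∃ λ w′ → w ≡ s ∷ w′
  hitting-head (hit _)      = _ , refl
  hitting-head (step _ _ _) = _ , refl

  -- A walk that stops on reaching `u ∷ T` visits `u` at most at its end; in that case one more
  -- step, to `y`, turns it into a walk that stops on reaching `T`.
  walk-settle : ∀ {T u v w y} → HittingWalk G (_∈ u ∷ T) v w → u ∉ T → y ∈ T → Adj u y →
                (HittingWalk G (_∈ T) v w × u ∉ w) ⊎
                (∃ λ W → w ≡ W ++ u ∷ [] × All (_∉ T) W × All (_≢ u) W ×
                         HittingWalk G (_∈ T) v (W ++ u ∷ y ∷ []))
  walk-settle (hit (here refl)) u∉T y∈T a = inj₂ ([] , refl , [] , [] , step u∉T a (hit y∈T))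
  walk-settle (hit (there t∈T)) u∉T y∈T a = inj₁ (hit t∈T , λ { (here refl) → u∉T t∈T })
  walk-settle {v = v} (step n b h) u∉T y∈T a with walk-settle h u∉T y∈T a
  ... | inj₁ (h′ , u∉w)            = inj₁ (step (n ∘ there) b h′ , λ { (here refl) → n (here refl) ; (there u∈w) → u∉w u∈w })
  ... | inj₂ (W , refl , W∉T , W≢u , h′) = inj₂ (v ∷ W , refl , (n ∘ there) ∷ W∉T , (λ { refl → n (here refl) }) ∷ W≢u , step (n ∘ there) b h′)

  -- The walk is split at its first visit to `c`. The last component allows the part from `x` on to
  -- be replaced, which is how the cycle gets inserted.
  walk-meets : ∀ {T v w} c → All (_∉ T) c → HittingWalk G (_∈ T) v w →
               All (_∉ c) w ⊎
               (∃ λ W → ∃ λ x → ∃ λ w′ → w ≡ W ++ x ∷ w′ × All (_∉ c) W × x ∈ c ×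
                  HittingWalk G (_∈ T) x (x ∷ w′) ×
                  (∀ {w″} → HittingWalk G (_∈ T) x (x ∷ w″) → HittingWalk G (_∈ T) v (W ++ x ∷ w″)))
  walk-meets c c∉T (hit t∈T) = inj₁ ((λ t∈c → All.lookup c∉T t∈c t∈T) ∷ [])
  walk-meets {v = v} c c∉T (step n a h) with v ∈? c
  ... | yes v∈c = inj₂ ([] , v , _ , refl , [] , v∈c , step n a h , id)
  ... | no  v∉c with walk-meets c c∉T h
  ...   | inj₁ w∉c = inj₁ (v∉c ∷ w∉c)
  ...   | inj₂ (W , x , w′ , refl , W∉c , x∈c , hx , k) =
    inj₂ (v ∷ W , x , w′ , refl , v∉c ∷ W∉c , x∈c , hx , step n a ∘ k)

  walk-loop : ∀ {T x y w} c → All (_∉ T) (x ∷ c) → Along Adj (x ∷ c ++ y ∷ []) →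
              HittingWalk G (_∈ T) y (y ∷ w) → HittingWalk G (_∈ T) x (x ∷ c ++ y ∷ w)
  walk-loop []      (x∉ ∷ _)  (a ∷ _)  h = step x∉ a h
  walk-loop (z ∷ c) (x∉ ∷ c∉) (a ∷ as) h = step x∉ a (walk-loop c c∉ as h)

  -- `Q` is the loop erasure of `w`. The field `edge` keeps it inside the tree prescribed by `E`,
  -- and `rest` says that the remaining stacks still complete the tree.
  record RunFrom (E : Rel V 0ℓ) (T : List V) (Σ : List (V × V)) (v : V) : Set where
    constructor runFrom
    field
      {w Q} : List V
      {Σ′}  : List (V × V)
      hits  : HittingWalk G (_∈ T) v w
      erase : Erase [] w Q
      edge  : Along E Q
      used  : Σ ~ steps w ++ Σ′
      rest  : Good G E (Q ++ T) Σ′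

  -- Induction on the first move. If `u` is settled and the walk avoids it, `u` is settled after the
  -- walk instead; if the walk ends at `u`, it takes one more step to `y`. A popped cycle that the
  -- walk avoids is popped after the walk; otherwise the walk goes round it once where it first
  -- meets it, which `erase-loop` undoes.
  good⇒runFrom : ∀ {E T Σ} → Good G E T Σ → ∀ v → RunFrom E T Σ v
  good⇒runFrom (done all) v = runFrom (hit (all v)) (fresh (λ ()) ∷ []) [] ~-refl (done (there ∘ all))
  good⇒runFrom {E} {T} {Σ} (settle {Σ′ = Σ₁} {u} {y} u∉T y∈T a e eqv g) v
    with good⇒runFrom g v
  ... | runFrom {w} {Q} {Σ₂} h er ed us re with walk-settle h u∉T y∈T a
  ...   | inj₁ (h′ , u∉w) = runFrom h′ er ed used
          (settle u∉ (∈-++⁺ʳ Q y∈T) a e ~-refl (good-≐ G i j re))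
    where
    u∉ : u ∉ Q ++ T
    u∉ u∈ with ∈-++⁻ Q u∈
    ... | inj₂ u∈T = u∉T u∈T
    ... | inj₁ u∈Q with erase-⊆ er u∈Q
    ...   | inj₂ u∈w = u∉w u∈w
    i : Q ++ u ∷ T ⊆ u ∷ Q ++ T
    i x∈ with ∈-++⁻ Q x∈
    ... | inj₁ x∈Q         = there (∈-++⁺ˡ x∈Q)
    ... | inj₂ (here refl) = here refl
    ... | inj₂ (there x∈T) = there (∈-++⁺ʳ Q x∈T)
    j : u ∷ Q ++ T ⊆ Q ++ u ∷ T
    j (here refl) = ∈-++⁺ʳ Q (here refl)
    j (there x∈) with ∈-++⁻ Q x∈
    ... | inj₁ x∈Q = ∈-++⁺ˡ x∈Q
    ... | inj₂ x∈T = ∈-++⁺ʳ Q (there x∈T)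
    used : Σ ~ steps w ++ (u , y) ∷ Σ₂
    used = ~-trans eqv (~-trans (prep (u , y) us) (pass (steps w)
      (All.map (λ s∈ u≡ → u∉w (subst (_∈ w) (sym u≡) s∈)) (sources-∈ w))))
  ...   | inj₂ (W , refl , W∉T , W≢u , h′) with erase-last W er
  ...     | R , refl = runFrom h′
            (subst (λ l → Erase [] l _) (++-assoc W (u ∷ []) (y ∷ [])) (erase-++ er (fresh y∉ ∷ [])))
            (subst (Along E) (sym (++-assoc R (u ∷ []) (y ∷ []))) (along-++⁺ R u (y ∷ []) ed (e ∷ [])))
            used (good-≐ G i j re)
    where
    -- The walk has avoided `T` so far, so `y` is new and loop erasure only appends it.
    y∉ : y ∉ R ++ u ∷ []
    y∉ y∈ with erase-⊆ er y∈
    ... | inj₂ y∈w with ∈-++⁻ W y∈w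
    ...   | inj₁ y∈W         = All.lookup W∉T y∈W y∈T
    ...   | inj₂ (here refl) = u∉T y∈T
    i : (R ++ u ∷ []) ++ u ∷ T ⊆ ((R ++ u ∷ []) ++ y ∷ []) ++ T
    i x∈ with ∈-++⁻ (R ++ u ∷ []) x∈
    ... | inj₁ x∈Q         = ∈-++⁺ˡ (∈-++⁺ˡ x∈Q)
    ... | inj₂ (here refl) = ∈-++⁺ˡ (∈-++⁺ˡ (∈-++⁺ʳ R (here refl)))
    ... | inj₂ (there x∈T) = ∈-++⁺ʳ ((R ++ u ∷ []) ++ y ∷ []) x∈T
    j : ((R ++ u ∷ []) ++ y ∷ []) ++ T ⊆ (R ++ u ∷ []) ++ u ∷ T
    j x∈ with ∈-++⁻ ((R ++ u ∷ []) ++ y ∷ []) x∈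
    ... | inj₂ x∈T = ∈-++⁺ʳ (R ++ u ∷ []) (there x∈T)
    ... | inj₁ x∈Q with ∈-++⁻ (R ++ u ∷ []) x∈Q
    ...   | inj₁ x∈′         = ∈-++⁺ˡ x∈′
    ...   | inj₂ (here refl) = ∈-++⁺ʳ (R ++ u ∷ []) (there y∈T)
    used : Σ ~ steps (W ++ u ∷ y ∷ []) ++ Σ₂
    used = ~-trans eqv (~-trans (prep (u , y) us)
      (~-trans (pass (steps (W ++ u ∷ [])) (All-sources W (All.map (λ x≢u u≡x → x≢u (sym u≡x)) W≢u)))
        (~-reflexive (trans (sym (++-assoc (steps (W ++ u ∷ [])) ((u , y) ∷ []) Σ₂))
          (cong (_++ Σ₂) (sym (steps-++ W u (y ∷ []))))))))
  good⇒runFrom {E} {T} {Σ} (pop {Σ′ = Σ₁} {z} {c} uc c∉T as eqv g) v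
    with good⇒runFrom g v
  ... | runFrom {w} {Q} {Σ₂} h er ed us re with walk-meets (z ∷ c) c∉T h
  ...   | inj₁ w∉c = runFrom h er ed
            (~-trans eqv (~-trans (++⁺ˡ loop us) (commute loop (steps w) apart)))
            (pop uc c∉ as ~-refl re)
    where
    loop = steps (z ∷ c ++ z ∷ [])
    apart : Apart loop (steps w)
    apart = All-sources (z ∷ c) (All.tabulate λ x∈c → All.map
      (λ s∈ x≡ → All.lookup w∉c s∈ (subst (_∈ z ∷ c) x≡ x∈c)) (sources-∈ w))
    c∉ : All (_∉ Q ++ T) (z ∷ c)
    c∉ = All.tabulate λ x∈c x∈ → go x∈c (∈-++⁻ Q x∈)
      where
      go : ∀ {x} → x ∈ z ∷ c → x ∈ Q ⊎ x ∈ T → _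
      go x∈c (inj₂ x∈T) = All.lookup c∉T x∈c x∈T
      go x∈c (inj₁ x∈Q) with erase-⊆ er x∈Q
      ... | inj₂ x∈w = All.lookup w∉c x∈w x∈c
  ...   | inj₂ (W , x , w′ , refl , W∉c , x∈c , hx , k) with rotate uc as x∈c | erase-++⁻ W er
  -- The cycle is based at `x`, where the walk first meets it; `P` is the path kept just before and
  -- avoids the cycle.
  ...     | d , d↭c , as′ , eqv′ | P , e₁ , e₂ = runFrom
            (k (walk-loop d (All-resp-↭ (↭-sym d↭c) c∉T) as′ hx))
            (erase-++ e₁ (erase-loop P x d (Unique-resp-↭ (↭-sym d↭c) uc) d∉P e₂))
            ed used re
    where
    d∉P : All (_∉ P) (x ∷ d)
    d∉P = All.tabulate λ y∈d y∈P → go y∈d (erase-⊆ e₁ y∈P)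
      where
      go : ∀ {y} → y ∈ x ∷ d → y ∈ [] ⊎ y ∈ W → _
      go y∈d (inj₂ y∈W) = All.lookup W∉c y∈W (∈-resp-↭ d↭c y∈d)
    stem = steps (W ++ x ∷ [])
    loop = steps (x ∷ d ++ x ∷ [])
    apart : Apart loop stem
    apart = apart-steps (x ∷ d) W (All.tabulate λ y∈d y∈W → All.lookup W∉c y∈W (∈-resp-↭ d↭c y∈d))
    used : Σ ~ steps (W ++ x ∷ d ++ x ∷ w′) ++ Σ₂
    used = ~-trans eqv (~-trans (++⁺ʳ Σ₁ eqv′) (~-trans (++⁺ˡ loop us)
        (~-trans (~-reflexive (cong (loop ++_) (begin
            steps (W ++ x ∷ w′) ++ Σ₂        ≡⟨ cong (_++ Σ₂) (steps-++ W x w′) ⟩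
            (stem ++ steps (x ∷ w′)) ++ Σ₂   ≡⟨ ++-assoc stem (steps (x ∷ w′)) Σ₂ ⟩
            stem ++ steps (x ∷ w′) ++ Σ₂     ∎)))
          (~-trans (commute loop stem apart) (~-reflexive (begin
            stem ++ loop ++ steps (x ∷ w′) ++ Σ₂
              ≡⟨ cong (stem ++_) (++-assoc loop (steps (x ∷ w′)) Σ₂) ⟨
            stem ++ (loop ++ steps (x ∷ w′)) ++ Σ₂
              ≡⟨ ++-assoc stem (loop ++ steps (x ∷ w′)) Σ₂ ⟨
            (stem ++ loop ++ steps (x ∷ w′)) ++ Σ₂
              ≡⟨ cong (λ l → (stem ++ l) ++ Σ₂) (steps-++ (x ∷ d) x w′) ⟨
            (stem ++ steps (x ∷ d ++ x ∷ w′)) ++ Σ₂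
              ≡⟨ cong (_++ Σ₂) (steps-++ W x (d ++ x ∷ w′)) ⟨
            steps (W ++ x ∷ d ++ x ∷ w′) ++ Σ₂ ∎))))))
      where open ≡-Reasoning

-- Runs of Wilson's algorithm and their stacks

module _ (G : FiniteGraph) where

  open FiniteGraph G
  open DecMembership _≟_ using (_∈?_)

  stack : Run G → List (V × V)
  stack ρ = concat (map steps ρ)

  good-spanning : ∀ {E T Σ} → (∀ v → v ∈ T) → Good G E T Σ → Σ ≡ []
  good-spanning all (done _)               = refl
  good-spanning all (settle u∉T _ _ _ _ _) = contradiction (all _) u∉T
  good-spanning all (pop _ (z∉T ∷ _) _ _ _) = contradiction (all _) z∉T

  Covers : Subgraph {V} → List V → Set
  Covers S o = ∀ v → v ∈ verts S ⊎ v ∈ o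

  covers-skip : ∀ {S v o} → v ∈ verts S → Covers S (v ∷ o) → Covers S o
  covers-skip v∈S cov u with cov u
  ... | inj₁ u∈S         = inj₁ u∈S
  ... | inj₂ (here refl) = inj₁ v∈S
  ... | inj₂ (there u∈o) = inj₂ u∈o

  covers-all : ∀ {S} → Covers S [] → ∀ v → v ∈ verts S
  covers-all cov v with cov v
  ... | inj₁ v∈S = v∈S

  loopErase-head : ∀ v w → ∃ λ R → loopErase G (v ∷ w) ≡ v ∷ R
  loopErase-head v w with loopErase-Erase G (v ∷ w)
  ... | x ∷ e = go x e refl
    where
    go : ∀ {P P′ Q} → Extend P v P′ → Erase P′ w Q → P ≡ [] → ∃ λ R → Q ≡ v ∷ R
    go (fresh _)     e refl = erase-head e
    go (cut [])      _ ()
    go (cut (_ ∷ _)) _ ()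

  covers-grow : ∀ {S v o} w → Covers S (v ∷ o) → Covers (grow G S (v ∷ w)) o
  covers-grow {S} {v} w cov u with cov u
  ... | inj₁ u∈S         = inj₁ (∈-++⁺ʳ (loopErase G (v ∷ w)) u∈S)
  ... | inj₂ (there u∈o) = inj₂ u∈o
  ... | inj₂ (here refl) with loopErase-head v w
  ...   | R , eq = inj₁ (∈-++⁺ˡ (subst (v ∈_) (sym eq) (here refl)))

  -- A walk can be read off from any vertex, so the stacks may be used in the order that `o`
  -- prescribes. Nothing is left over, since no move is possible once the tree spans the graph.
  good⇒run : ∀ {E Σ} S o → Covers S o → Good G E (verts S) Σ →
             ∃ λ ρ → Completes G S o ρ × Σ ~ stack ρ
  good⇒run S [] cov g = [] , done , ~-reflexive (good-spanning (covers-all {S} cov) g)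
  good⇒run S (v ∷ o) cov g with v ∈? verts S
  ... | yes v∈S = let ρ , c , eqv = good⇒run S o (covers-skip {S} v∈S cov) g in ρ , skip v∈S c , eqv
  ... | no  v∉S with good⇒runFrom G g v
  ...   | runFrom {w} {Q} h er _ us re with hitting-head G h
  ...     | w′ , refl with good⇒run (grow G S (v ∷ w′)) o (covers-grow {S} w′ cov)
                             (subst (λ l → Good G _ (l ++ verts S) _) (sym (Erase⇒loopErase G er)) re)
  ...       | ρ , c , eqv = w ∷ ρ , walk v∉S h c , ~-trans us (++⁺ˡ (steps w) eqv)

  edges-grows : ∀ S ρ → edges S ⊆ edges (foldl (grow G) S ρ)
  edges-grows S []      s∈ = s∈
  edges-grows S (w ∷ ρ) s∈ = edges-grows (grow G S w) ρ (∈-++⁺ʳ (steps (loopErase G w)) s∈)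

  -- `unwalk` applies to each walk in turn, as its loop erasure consists of edges of the final tree.
  -- Taking these edges for `E` later keeps the tree fixed when the stacks are used in another
  -- order.
  run⇒good : ∀ {E S o ρ} → Completes G S o ρ → Covers S o →
             (∀ {s} → s ∈ edges (foldl (grow G) S ρ) → uncurry E s) →
             Good G E (verts S) (stack ρ)
  run⇒good {S = S} done cov _ = done (covers-all {S} cov)
  run⇒good {S = S} (skip v∈S c) cov E⊇ = run⇒good c (covers-skip {S} v∈S cov) E⊇
  run⇒good {E} {S} (walk {v} {o} {w} {ρ} v∉S h c) cov E⊇ with hitting-head G h
  ... | w′ , refl = unwalk G h refl ([] ∷ []) [] [] (tail (loopErase-Erase G w) refl)
          (All.tabulate λ s∈ → E⊇ (edges-grows (grow G S w) ρ (∈-++⁺ˡ s∈)))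
          (run⇒good c (covers-grow {S} w′ cov) E⊇)
    where
    tail : ∀ {P Q} → Erase P (v ∷ w′) Q → P ≡ [] → Erase (v ∷ []) w′ Q
    tail (fresh _ ∷ e)     refl = e
    tail (cut [] ∷ _)      ()
    tail (cut (_ ∷ _) ∷ _) ()

  _≈_ : List (V × V) → List (V × V) → Set
  xs ≈ ys = ∀ z → exits _≟_ z xs ≡ exits _≟_ z ys

  ≈-∷⁻ : ∀ {s u u′ xs xs′} → ((s , u) ∷ xs) ≈ ((s , u′) ∷ xs′) → u ≡ u′ × xs ≈ xs′
  ≈-∷⁻ {s} {u} {u′} {xs} {xs′} eq = proj₁ here≡ , rest
    where
    here≡ : u ≡ u′ × exits _≟_ s xs ≡ exits _≟_ s xs′
    here≡ = ∷-injective (trans (sym (exits-here _≟_ s)) (trans (eq s) (exits-here _≟_ s)))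
    rest : xs ≈ xs′
    rest z with z ≟ s
    ... | yes refl = proj₂ here≡
    ... | no  z≢s  = trans (sym (exits-there _≟_ z≢s)) (trans (eq z) (exits-there _≟_ z≢s))

  -- The next vertex is always the top of the stack at the current one, and the walk stops exactly
  -- when it reaches `S`.
  walk-determined : ∀ {S s w w′ xs xs′} → HittingWalk G S s w → HittingWalk G S s w′ →
                    (steps w ++ xs) ≈ (steps w′ ++ xs′) → w ≡ w′ × xs ≈ xs′
  walk-determined (hit _)      (hit _)      eq = refl , eq
  walk-determined (hit p)      (step n _ _) eq = contradiction p n
  walk-determined (step n _ _) (hit p)      eq = contradiction p n
  walk-determined {s = s} (step _ _ h) (step _ _ h′) eq with hitting-head G h | hitting-head G h′
  ... | _ , refl | _ , refl with ≈-∷⁻ eq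
  ...   | refl , eq′ with walk-determined h h′ eq′
  ...     | refl , eq″ = refl , eq″

  run-determined : ∀ {S o ρ ρ′} → Completes G S o ρ → Completes G S o ρ′ →
                   stack ρ ≈ stack ρ′ → ρ ≡ ρ′
  run-determined done         done          eq = refl
  run-determined (skip _ c)   (skip _ c′)   eq = run-determined c c′ eq
  run-determined (skip v∈ c)  (walk v∉ _ _) eq = contradiction v∈ v∉
  run-determined (walk v∉ _ _) (skip v∈ _)  eq = contradiction v∈ v∉
  run-determined (walk _ h c) (walk _ h′ c′) eq with walk-determined h h′ eq
  ... | refl , eq′ = cong (_ ∷_) (run-determined c c′ eq′)

  weight : List (V × V) → ℚ
  weight = foldr (λ s q → reciprocal G (deg (proj₁ s)) * q) 1ℚ

  weight-~ : ∀ {xs ys} → xs ~ ys → weight xs ≡ weight ys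
  weight-~ ~-refl        = refl
  weight-~ (prep s p)    = cong (reciprocal G (deg (proj₁ s)) *_) (weight-~ p)
  weight-~ (~-trans p q) = trans (weight-~ p) (weight-~ q)
  weight-~ (swap {s} {t} {xs} _) = begin
    a * (b * c) ≡⟨ ℚ.*-assoc a b c ⟨
    (a * b) * c ≡⟨ cong (_* c) (ℚ.*-comm a b) ⟩
    (b * a) * c ≡⟨ ℚ.*-assoc b a c ⟩
    b * (a * c) ∎
    where
    open ≡-Reasoning
    a = reciprocal G (deg (proj₁ s))
    b = reciprocal G (deg (proj₁ t))
    c = weight xs

  weight-++ : ∀ xs ys → weight (xs ++ ys) ≡ weight xs * weight ys
  weight-++ []       ys = sym (ℚ.*-identityˡ (weight ys))
  weight-++ (x ∷ xs) ys = trans (cong (reciprocal G (deg (proj₁ x)) *_) (weight-++ xs ys)) (sym (ℚ.*-assoc (reciprocal G (deg (proj₁ x))) (weight xs) (weight ys)))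

  walkProbability≡weight : ∀ w → walkProbability G w ≡ weight (steps w)
  walkProbability≡weight []          = refl
  walkProbability≡weight (x ∷ [])    = refl
  walkProbability≡weight (x ∷ y ∷ w) = cong (reciprocal G (deg x) *_) (walkProbability≡weight (y ∷ w))

  runProbability≡weight : ∀ ρ → runProbability G ρ ≡ weight (stack ρ)
  runProbability≡weight []      = refl
  runProbability≡weight (w ∷ ρ) = trans (cong₂ _*_ (walkProbability≡weight w) (runProbability≡weight ρ))
                                        (sym (weight-++ (steps w) (stack ρ)))

  -- The run is turned into stacks, and a run that begins with a walk from `v` is read off from
  -- them. If `v` occurs in `o`, it is skipped there, being already in the tree.
  reorder : ∀ {E S o ρ} → Completes G S o ρ → Covers S o →
            (∀ {s} → s ∈ edges (foldl (grow G) S ρ) → uncurry E s) → ∀ v →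
            ∃ λ w → ∃ λ ρ′ → HittingWalk G (_∈ verts S) v w × Along E (loopErase G w) ×
              Completes G (grow G S w) o ρ′ × stack ρ ~ stack (w ∷ ρ′)
  reorder {E} {S} {o} c cov E⊇ v with good⇒runFrom G (run⇒good c cov E⊇) v
  ... | runFrom {w} h er ed us re
    with good⇒run (grow G S w) o cov′ (subst (λ l → Good G _ (l ++ verts S) _) (sym (Erase⇒loopErase G er)) re)
    where
    cov′ : Covers (grow G S w) o
    cov′ u with cov u
    ... | inj₁ u∈S = inj₁ (∈-++⁺ʳ (loopErase G w) u∈S)
    ... | inj₂ u∈o = inj₂ u∈o
  ...   | ρ′ , c′ , eqv = w , ρ′ , h , subst (Along E) (sym (Erase⇒loopErase G er)) ed , c′ ,
          ~-trans us (++⁺ˡ (steps w) eqv)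

-- The final tree and its branches

module _ {V : Set} where

  along⇒linked : ∀ {R : Rel V 0ℓ} w → Along R w → Linked R w
  along⇒linked []          _        = []
  along⇒linked (x ∷ [])    _        = [-]
  along⇒linked (x ∷ y ∷ w) (r ∷ rs) = r ∷ along⇒linked (y ∷ w) rs

  targets-∈ : ∀ w → All (λ (s : V × V) → proj₂ s ∈ w) (steps w)
  targets-∈ []          = []
  targets-∈ (x ∷ [])    = []
  targets-∈ (x ∷ y ∷ w) = there (here refl) ∷ All.map there (targets-∈ (y ∷ w))

  -- The kept path always ends at the current position `u` of the walk, so appending uses a step of
  -- the walk, and cutting leaves a prefix.
  erase-along : ∀ {R : Rel V 0ℓ} {P u S w Q} → S ≡ P ++ u ∷ [] → Along R S → Along R (u ∷ w) →
                Erase S w Q → Along R Q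
  erase-along S≡ rS rw [] = rS
  erase-along {R} {P} {u} {S} S≡ rS (r ∷ rw) (fresh {v = v} _ ∷ e) =
    erase-along {P = S} refl
      (subst (Along R) (trans (sym (++-assoc P (u ∷ []) (v ∷ []))) (cong (_++ v ∷ []) (sym S≡)))
        (along-++⁺ P u (v ∷ []) (subst (Along R) S≡ rS) (r ∷ [])))
      rw e
  erase-along S≡ rS (r ∷ rw) (cut a {v} {b} ∷ e) =
    erase-along {P = a} refl (proj₁ (along-++⁻ a v b rS)) rw e

  NoBacktrack : List V → Set
  NoBacktrack (x ∷ y ∷ z ∷ w) = x ≢ z × NoBacktrack (y ∷ z ∷ w)
  NoBacktrack _               = ⊤

  noBacktrack-tail : ∀ x {w} → NoBacktrack (x ∷ w) → NoBacktrack w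
  noBacktrack-tail x {[]}        _        = tt
  noBacktrack-tail x {_ ∷ []}    _        = tt
  noBacktrack-tail x {_ ∷ _ ∷ _} (_ , nb) = nb

  noBacktrack : ∀ w {y u} → Unique (w ++ y ∷ []) → u ∉ w → NoBacktrack (w ++ y ∷ u ∷ [])
  noBacktrack []               _                  _   = tt
  noBacktrack (x ∷ [])         _                  u∉w = (λ { refl → u∉w (here refl) }) , tt
  noBacktrack (x ∷ x′ ∷ [])     ((_ ∷ p ∷ _) ∷ uw) u∉w = p , noBacktrack (x′ ∷ []) uw (u∉w ∘ there)
  noBacktrack (x ∷ x′ ∷ x″ ∷ w) ((_ ∷ p ∷ _) ∷ uw) u∉w = p , noBacktrack (x′ ∷ x″ ∷ w) uw (u∉w ∘ there)

  -- Edges point from a vertex to its parent; a walk that does not backtrack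
  -- climbs and then descends, so it cannot close up.
  module Ranked (E : Rel V 0ℓ) (functional : ∀ {u v v′} → E u v → E u v′ → v ≡ v′)
                (rank : V → ℕ) (decreasing : ∀ {u v} → E u v → rank v ℕ.< rank u) where

    -- After a step from the parent `a` to its child `b`, the only edge out of `b` leads back to
    -- `a`, so every later step goes to a child as well.
    descend : ∀ w {a b y z} → E b a → Linked (SymClosure E) (b ∷ w ++ y ∷ z ∷ []) →
              NoBacktrack (a ∷ b ∷ w ++ y ∷ z ∷ []) → rank a ℕ.< rank z × E z y
    descend [] {a} {b} {y} {z} e (j ∷ j′ ∷ [-]) (a≢y , b≢z , _) with j | j′
    ... | fwd b→y | _       = contradiction (functional e b→y) a≢y
    ... | bwd y→b | fwd y→z = contradiction (functional y→b y→z) b≢z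
    ... | bwd y→b | bwd z→y =
      ℕ.<-trans (decreasing e) (ℕ.<-trans (decreasing y→b) (decreasing z→y)) , z→y
    descend (c ∷ w) e (fwd b→c ∷ js) (a≢c , nb) = contradiction (functional e b→c) a≢c
    descend (c ∷ w) e (bwd c→b ∷ js) (a≢c , nb) with descend w c→b js nb
    ... | lt , z→y = ℕ.<-trans (decreasing e) lt , z→y

    climb : ∀ w {a y z} → Linked (SymClosure E) (a ∷ w ++ y ∷ z ∷ []) →
            NoBacktrack (a ∷ w ++ y ∷ z ∷ []) → rank z ℕ.< rank a ⊎ E z y
    climb [] (_ ∷ bwd z→y ∷ [-]) _ = inj₂ z→y
    climb [] (fwd a→y ∷ fwd y→z ∷ [-]) _ = inj₁ (ℕ.<-trans (decreasing y→z) (decreasing a→y))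
    climb [] (bwd y→a ∷ fwd y→z ∷ [-]) (a≢z , _) = contradiction (functional y→a y→z) a≢z
    climb (b ∷ w) {a} (fwd a→b ∷ js) nb with climb w js (noBacktrack-tail a nb)
    ... | inj₁ lt  = inj₁ (ℕ.<-trans lt (decreasing a→b))
    ... | inj₂ z→y = inj₂ z→y
    climb (b ∷ w) (bwd b→a ∷ js) nb = inj₂ (proj₂ (descend w b→a js nb))

    acyclic : ∀ u p → ¬ IsCycle (SymClosure E) u p
    acyclic u [] (() , _)
    acyclic u (p ∷ q) (2≤ , uniq , linked) with initLast q
    acyclic u (p ∷ .[]) (s≤s () , uniq , linked) | []
    acyclic u (p ∷ .(q ++ y ∷ [])) (2≤ , (u≢p ∷ u≢q) ∷ uq , j ∷ linked) | q ∷ʳ′ y =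
      go j
      where
      js : Linked (SymClosure E) (p ∷ q ++ y ∷ u ∷ [])
      js = subst (λ l → Linked (SymClosure E) (p ∷ l)) (++-assoc q (y ∷ []) (u ∷ [])) linked
      u∉pq : u ∉ p ∷ q
      u∉pq (here refl) = u≢p refl
      u∉pq (there u∈q) = All.lookup u≢q (∈-++⁺ˡ u∈q) refl
      first : ∀ q {y} → All (u ≢_) (q ++ y ∷ []) → NoBacktrack (p ∷ q ++ y ∷ u ∷ []) →
              NoBacktrack (u ∷ p ∷ q ++ y ∷ u ∷ [])
      first []      (u≢ ∷ _) nb = u≢ , nb
      first (_ ∷ _) (u≢ ∷ _) nb = u≢ , nb
      nb : NoBacktrack (u ∷ p ∷ q ++ y ∷ u ∷ [])
      nb = first q u≢q (noBacktrack (p ∷ q) uq u∉pq)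
      go : SymClosure E u p → _
      go (bwd p→u) = ℕ.<-irrefl refl (proj₁ (descend q p→u js nb))
      go (fwd u→p) with climb (p ∷ q) (fwd u→p ∷ js) nb
      ... | inj₁ lt  = ℕ.<-irrefl refl lt
      -- The cycle leaves `u` for its parent and also comes back from it, so its second and its last
      -- vertex coincide.
      ... | inj₂ u→y with functional u→p u→y
      ...   | refl = All.lookup (AllPairs.head uq) (∈-++⁺ʳ q (here refl)) refl

module _ (G : FiniteGraph) where

  open FiniteGraph G
  open DecMembership _≟_ using (_∈?_)

  -- The history of a growing tree, most recent vertex first, with every edge directed from a vertex
  -- to its parent.
  data Forest (r : V) : List V → List (V × V) → Set where
    root : Forest r (r ∷ []) []
    leaf : ∀ {vs es u y} → u ∉ vs → y ∈ vs → Adj u y → Forest r vs es →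
           Forest r (u ∷ vs) ((u , y) ∷ es)

  forest-source : ∀ {r vs es u v} → Forest r vs es → (u , v) ∈ es → u ∈ vs
  forest-source (leaf _ _ _ f) (here refl) = here refl
  forest-source (leaf _ _ _ f) (there e)   = there (forest-source f e)

  forest-target : ∀ {r vs es u v} → Forest r vs es → (u , v) ∈ es → v ∈ vs
  forest-target (leaf _ y∈ _ f) (here refl) = there y∈
  forest-target (leaf _ _ _ f)  (there e)   = there (forest-target f e)

  forest-functional : ∀ {r vs es u v v′} → Forest r vs es → (u , v) ∈ es → (u , v′) ∈ es → v ≡ v′
  forest-functional (leaf _ _ _ f)  (here refl) (here refl) = refl
  forest-functional (leaf u∉ _ _ f) (here refl) (there e)   = contradiction (forest-source f e) u∉
  forest-functional (leaf u∉ _ _ f) (there e)   (here refl) = contradiction (forest-source f e) u∉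
  forest-functional (leaf _ _ _ f)  (there e)   (there e′)  = forest-functional f e e′

  -- The time at which `v` was attached, which is later than that of its parent.
  rank : List (V × V) → V → ℕ
  rank []             v = 0
  rank ((u , y) ∷ es) v with v ≟ u
  ... | yes _ = suc (length es)
  ... | no  _ = rank es v

  rank-≤ : ∀ es v → rank es v ℕ.≤ length es
  rank-≤ []             v = z≤n
  rank-≤ ((u , y) ∷ es) v with v ≟ u
  ... | yes _ = ℕ.≤-refl
  ... | no  _ = ℕ.m≤n⇒m≤1+n (rank-≤ es v)

  forest-rank : ∀ {r vs es u v} → Forest r vs es → (u , v) ∈ es → rank es v ℕ.< rank es u
  forest-rank {v = v} (leaf {es = es} {u} u∉ y∈ _ f) (here refl) with u ≟ u | v ≟ u
  ... | no u≢u | _        = contradiction refl u≢u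
  ... | yes _  | yes refl = contradiction y∈ u∉
  ... | yes _  | no  _    = s≤s (rank-≤ es v)
  forest-rank {u = u} {v} (leaf {u = x} u∉ _ _ f) (there e) with u ≟ x | v ≟ x
  ... | yes refl | _        = contradiction (forest-source f e) u∉
  ... | no _     | yes refl = contradiction (forest-target f e) u∉
  ... | no _     | no _     = forest-rank f e

  forest-adj : ∀ {r vs es u v} → Forest r vs es → (u , v) ∈ es → Adj u v
  forest-adj (leaf _ _ a f) (here refl) = a
  forest-adj (leaf _ _ a f) (there e)   = forest-adj f e

  forest-rooted : ∀ {r vs es v} → Forest r vs es → v ∈ vs → Star (λ u y → (u , y) ∈ es) v r
  forest-rooted root             (here refl) = ε
  forest-rooted (leaf _ y∈ _ f)  (here refl) = here refl ◅ Star.map there (forest-rooted f y∈)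
  forest-rooted (leaf _ _ _ f)   (there v∈)  = Star.map there (forest-rooted f v∈)

  forest-attach : ∀ {r vs es} R {t} → Unique R → All (_∉ vs) R → t ∈ vs → Along Adj (R ++ t ∷ []) →
                  Forest r vs es → Forest r (R ++ vs) (steps (R ++ t ∷ []) ++ es)
  forest-attach []          _         _          t∈ _        f = f
  forest-attach (p ∷ [])    _         (p∉ ∷ [])  t∈ (a ∷ []) f = leaf p∉ t∈ a f
  forest-attach {vs = vs} (p ∷ q ∷ R) (p≢ ∷ u) (p∉ ∷ R∉) t∈ (a ∷ as) f =
    leaf p∉′ (here refl) a (forest-attach (q ∷ R) u R∉ t∈ as f)
    where
    p∉′ : p ∉ (q ∷ R) ++ vs
    p∉′ p∈ with ∈-++⁻ (q ∷ R) p∈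
    ... | inj₁ x = All.lookup p≢ x refl
    ... | inj₂ x = p∉ x

  hitting-snoc : ∀ {S v w} → HittingWalk G S v w → ∃ λ W → ∃ λ t → w ≡ W ++ t ∷ [] × S t × All (¬_ ∘ S) W
  hitting-snoc (hit s)      = [] , _ , refl , s , []
  hitting-snoc (step n _ h) with hitting-snoc h
  ... | W , t , refl , s , ns = _ ∷ W , t , refl , s , n ∷ ns

  hitting-along : ∀ {S v w} → HittingWalk G S v w → Along Adj w
  hitting-along (hit _) = []
  hitting-along (step _ a h) with hitting-head G h
  ... | _ , refl = a ∷ hitting-along h

  record PathTo (T : List V) (v : V) (Q : List V) : Set where
    field
      {stem}  : List V
      {tip}   : V
      shape   : Q ≡ stem ++ tip ∷ []
      starts  : ∃ λ R → Q ≡ v ∷ R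
      tip∈    : tip ∈ T
      stem∉   : All (_∉ T) stem
      simple  : Unique Q
      path    : Along Adj Q

  loopErase-path : ∀ {T v w} → HittingWalk G (_∈ T) v w → PathTo T v (loopErase G w)
  loopErase-path {T} {v} {w} h with hitting-head G h | hitting-snoc h | loopErase-Erase G w | hitting-along h
  ... | w′ , refl | W , t , w≡ , t∈ , W∉ | e | as
    with erase-last W (subst (λ l → Erase [] l _) w≡ e)
  ...   | R , Q≡ = record
    { shape  = Q≡
    ; starts = loopErase-head G v w′
    ; tip∈   = t∈
    ; stem∉  = All.tabulate stem∉
    ; simple = uniq
    ; path   = start e refl
    }
    where
    uniq : Unique (loopErase G w)
    uniq = erase-unique [] e
    -- Only the last vertex `t` of the walk lies in `T`, and a simple path ending in `t` contains it
    -- nowhere else.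
    stem∉ : ∀ {x} → x ∈ R → x ∉ T
    stem∉ {x} x∈R with erase-⊆ e (subst (x ∈_) (sym Q≡) (∈-++⁺ˡ x∈R))
    ... | inj₂ x∈w with ∈-++⁻ W (subst (x ∈_) w≡ x∈w)
    ...   | inj₁ x∈W         = All.lookup W∉ x∈W
    ...   | inj₂ (here refl) = contradiction (here refl)
            (All.lookup (proj₂ (proj₂ (unique-split R (subst Unique Q≡ uniq)))) x∈R)
    start : ∀ {P Q} → Erase P (v ∷ w′) Q → P ≡ [] → Along Adj Q
    start (fresh _ ∷ e)     refl = erase-along {P = []} refl [] as e
    start (cut [] ∷ _)      ()
    start (cut (_ ∷ _) ∷ _) ()

  root∈loopErase : ∀ {r x w} → HittingWalk G (_∈ r ∷ []) x w → r ∈ loopErase G w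
  root∈loopErase {r} {w = w} h =
    go tip∈ (subst (tip ∈_) (sym shape) (∈-++⁺ʳ stem (here refl)))
    where
    open PathTo (loopErase-path h)
    go : ∀ {t} → t ∈ r ∷ [] → t ∈ loopErase G w → r ∈ loopErase G w
    go (here refl) t∈ = t∈

  -- `verts S` repeats the tip of every added path, so the forest carries its own list `vs` with the
  -- same elements.
  forest-run : ∀ {r S o ρ vs} → Completes G S o ρ → Covers G S o → Forest r vs (edges S) →
               vs ⊆ verts S → verts S ⊆ vs →
               let T = foldl (grow G) S ρ in
               (∀ v → v ∈ verts T) × ∃ λ vs′ → Forest r vs′ (edges T) × (∀ v → v ∈ vs′)
  forest-run {S = S} {vs = vs} done cov f i j = covers-all G {S} cov , vs , f , j ∘ covers-all G {S} cov
  forest-run {S = S} (skip v∈ c) cov f i j = forest-run c (covers-skip G {S} v∈ cov) f i j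
  forest-run {r} {S} {vs = vs} (walk {v} {w = w} v∉ h c) cov f i j with hitting-head G h | loopErase-path h
  ... | w′ , refl | br with PathTo.stem br | PathTo.tip br | PathTo.shape br | PathTo.tip∈ br | PathTo.stem∉ br | PathTo.simple br | PathTo.path br
  ...   | R | t | shape | t∈ | R∉ | uniq | as =
    forest-run c (covers-grow G {S} w′ cov) attached i′ j′
    where
    attached : Forest r (R ++ vs) (steps (loopErase G w) ++ edges S)
    attached = subst (λ l → Forest r (R ++ vs) (steps l ++ edges S)) (sym shape)
      (forest-attach R (unique-++⁻ˡ R (subst Unique shape uniq)) (All.map (_∘ i) R∉) (j t∈)
        (subst (Along Adj) shape as) f)
    i′ : R ++ vs ⊆ loopErase G w ++ verts S
    i′ {x} x∈ with ∈-++⁻ R x∈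
    ... | inj₁ x∈R = ∈-++⁺ˡ (subst (x ∈_) (sym shape) (∈-++⁺ˡ x∈R))
    ... | inj₂ x∈S = ∈-++⁺ʳ (loopErase G w) (i x∈S)
    j′ : loopErase G w ++ verts S ⊆ R ++ vs
    j′ {x} x∈ with ∈-++⁻ (loopErase G w) x∈
    ... | inj₂ x∈S = ∈-++⁺ʳ R (j x∈S)
    ... | inj₁ x∈Q with ∈-++⁻ R (subst (x ∈_) shape x∈Q)
    ...   | inj₁ x∈R         = ∈-++⁺ˡ x∈R
    ...   | inj₂ (here refl) = ∈-++⁺ʳ R (j t∈)

  -- An edge added later leaves a vertex on the stem of a new path, which was not in the tree
  -- before. This will show that the first path is closed under taking parents.
  late-edge : ∀ {S o ρ u v} → Completes G S o ρ → (u , v) ∈ edges (foldl (grow G) S ρ) →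
              (u , v) ∈ edges S ⊎ u ∉ verts S
  late-edge done       e = inj₁ e
  late-edge (skip _ c) e = late-edge c e
  late-edge (walk {w = w} _ h c) e with late-edge c e
  ... | inj₂ u∉ = inj₂ (u∉ ∘ ∈-++⁺ʳ (loopErase G w))
  ... | inj₁ e′ with ∈-++⁻ (steps (loopErase G w)) e′
  ...   | inj₂ e∈S = inj₁ e∈S
  ...   | inj₁ e∈Q = inj₂ (All.lookup (All-sources stem stem∉) (subst (λ l → _ ∈ steps l) shape e∈Q))
    where open PathTo (loopErase-path h)

  module _ {r : V} {o : List V} (ordering : IsOrdering G r o) where

    covers-ordering : Covers G (singleton r) o
    covers-ordering v with v ≟ r
    ... | yes refl = inj₁ (here refl)
    ... | no  v≢r  = inj₂ (Equivalence.from (proj₂ ordering v) v≢r)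

    isSpanningTree : ∀ {ρ} → IsRun G r o ρ → IsSpanningTree G (finalTree G r ρ)
    isSpanningTree {ρ} c with forest-run c covers-ordering root id id
    ... | all , vs , f , all′ = record
      { spanning  = all
      ; inside    = λ { (fwd e) → forest-adj f e ; (bwd e) → adj-sym (forest-adj f e) }
      ; connected = λ u v → up u ◅◅ Star.reverse (symmetric _) (up v)
      ; acyclic   = acyclic
      }
      where
      open Ranked (λ u v → (u , v) ∈ edges (finalTree G r ρ)) (forest-functional f) (rank (edges (finalTree G r ρ))) (forest-rank f)
      up : ∀ u → Star (Joined (finalTree G r ρ)) u r
      up u = Star.map fwd (forest-rooted f (all′ u))

-- Branches off a path closed under parents

module _ {V : Set} (_≟_ : DecidableEquality V) (T : Subgraph {V}) (L : List V)
         (functional : ∀ {u v v′} → (u , v) ∈ edges T → (u , v′) ∈ edges T → v ≡ v′)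
         (closed : ∀ {u v} → (u , v) ∈ edges T → u ∈ L → v ∈ L) where

  open DecMembership _≟_ using (_∈?_)

  -- `a` is the first vertex of `L` met on following parent edges from `v`.
  data Exit : V → V → Set where
    last : ∀ {v a} → v ∉ L → a ∈ L → (v , a) ∈ edges T → Exit v a
    next : ∀ {v u a} → v ∉ L → (v , u) ∈ edges T → Exit u a → Exit v a

  exit-∉ : ∀ {v a} → Exit v a → v ∉ L
  exit-∉ (last v∉ _ _) = v∉
  exit-∉ (next v∉ _ _) = v∉

  exit-unique : ∀ {v a a′} → Exit v a → Exit v a′ → a ≡ a′
  exit-unique (last _ _ e) (last _ _ e′) = functional e e′
  exit-unique (last _ a∈ e) (next _ e′ x) with functional e e′
  ... | refl = contradiction a∈ (exit-∉ x)
  exit-unique (next _ e x) (last _ a∈ e′) with functional e e′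
  ... | refl = contradiction a∈ (exit-∉ x)
  exit-unique (next _ e x) (next _ e′ x′) with functional e e′
  ... | refl = exit-unique x x′

  exit-edge : ∀ {u v a} → (u , v) ∈ edges T → v ∉ L → Exit u a → Exit v a
  exit-edge e v∉ (last _ a∈ e′) with functional e e′
  ... | refl = contradiction a∈ v∉
  exit-edge e v∉ (next _ e′ x) with functional e e′
  ... | refl = x

  exit-component : ∀ {u v a} → Component (Joined T) L u v → Exit u a → Exit v a
  exit-component ε x = x
  exit-component ((fwd e , u∉ , v∉) ◅ s) x = exit-component s (exit-edge e v∉ x)
  exit-component ((bwd e , u∉ , v∉) ◅ s) x = exit-component s (next v∉ e x)

  exit-component⁻ : ∀ {u v a} → Component (Joined T) L u v → Exit v a → Exit u a
  exit-component⁻ ε x = x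
  exit-component⁻ ((fwd e , u∉ , v∉) ◅ s) x = next u∉ e (exit-component⁻ s x)
  exit-component⁻ ((bwd e , u∉ , v∉) ◅ s) x = exit-edge e u∉ (exit-component⁻ s x)

  -- Since `L` is closed under parents, the edge between the component and `a` is directed towards
  -- `a`; so `a` is the exit of one vertex of the component, hence of all.
  attachment-exit : ∀ {b v a} → b ∉ L → IsAttachment (Joined T) L (Component (Joined T) L b) a →
                    Component (Joined T) L b v → Exit v a
  attachment-exit {b} {v} {a} b∉ (a∈ , v′ , comp′ , j) comp =
    exit-component comp (exit-component⁻ comp′ (go j))
    where
    outside : ∀ {u v} → Component (Joined T) L u v → u ∉ L → v ∉ L
    outside ε                  u∉ = u∉
    outside ((_ , _ , v∉) ◅ s) _  = outside s v∉
    go : Joined T v′ a → Exit v′ a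
    go (fwd e) = last (outside comp′ b∉) a∈ e
    go (bwd e) = contradiction (closed e a∈) (outside comp′ b∉)

  path-exit : ∀ {v} q → v ∉ L → Along (λ u y → (u , y) ∈ edges T) (v ∷ q) → Any (_∈ L) q →
              ∃ λ a → Exit v a × ∃ λ (s : Star (Joined T) v a) → ∣ s ∣ ℕ.≤ length q
  path-exit (x ∷ q) v∉ (e ∷ es) any with x ∈? L
  ... | yes x∈ = x , last v∉ x∈ e , fwd e ◅ ε , s≤s z≤n
  path-exit (x ∷ q) v∉ (e ∷ es) (here x∈) | no x∉ = contradiction x∈ x∉
  path-exit (x ∷ q) v∉ (e ∷ es) (there any) | no x∉ =
    let a , ex , s , ≤q = path-exit q x∉ es any in a , next v∉ e ex , fwd e ◅ s , s≤s ≤q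

  -- `v` is a vertex of the branch farthest from the attachment point. Parent edges from `v` first
  -- meet `L` at that point, so a path of them that meets `L` is at least as long as the branch.
  branch-path : ∀ {l} → HasBranchOfLengthAtLeast T L l →
                ∃ λ v → v ∉ L × ∀ q → Along (λ u y → (u , y) ∈ edges T) (v ∷ q) → Any (_∈ L) q → l ℕ.≤ length q
  branch-path (b , b∉ , a , att , k , ((v , comp , _ , shortest) , _) , l≤k) =
    v , v∉ , λ q es any → ℕ.≤-trans l≤k (bound q es any)
    where
    v∉ : v ∉ L
    v∉ = exit-∉ (attachment-exit b∉ att comp)
    bound : ∀ q → _ → _ → k ℕ.≤ length q
    bound q es any with path-exit q v∉ es any
    ... | a′ , ex , s , ≤q with exit-unique ex (attachment-exit b∉ att comp)
    ...   | refl = ℕ.≤-trans (shortest s) ≤q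

module _ (G : FiniteGraph) where

  open FiniteGraph G

  record Reordered (r : V) (w₁ : List V) (o : List V) (ρ : Run G) (l : ℕ) (v : V) : Set where
    constructor reordered
    field
      w     : List V
      ρ′    : Run G
      hits  : HittingWalk G (_∈ verts (grow G (singleton r) w₁)) v w
      long  : l ℕ.< length w
      run   : Completes G (grow G (grow G (singleton r) w₁) w) o ρ′
      same  : stack G ρ ~ stack G (w ∷ ρ′)

  -- The walk from `v` after reordering has a loop erasure made of parent edges of the same final
  -- tree, so `branch-path` bounds its length from below, and the walk is no shorter.
  branch⇒reordered : ∀ {r x o w₁ ρ l} → IsOrdering G r (x ∷ o) → HittingWalk G (_∈ r ∷ []) x w₁ →
    Completes G (grow G (singleton r) w₁) o ρ →
    HasBranchOfLengthAtLeast (finalTree G r (w₁ ∷ ρ)) (firstPath G (w₁ ∷ ρ)) l →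
    ∃ λ v → Reordered r w₁ o ρ l v
  branch⇒reordered {r} {x} {o} {w₁} {ρ} {l} ord h₁ c br
    with hitting-head G h₁ | forest-run G (walk (λ { (here refl) → Equivalence.to (proj₂ ord r) (here refl) refl }) h₁ c) (covers-ordering G ord) root id id
  ... | w′ , refl | all , vs , f , all′ with branch-path _≟_ T L (forest-functional G f) closed br
    where
    T = finalTree G r (w₁ ∷ ρ)
    L = loopErase G w₁
    closed : ∀ {u v} → (u , v) ∈ edges T → u ∈ L → v ∈ L
    closed e u∈ with late-edge G c e
    ... | inj₂ u∉ = contradiction (∈-++⁺ˡ u∈) u∉
    ... | inj₁ e′ with ∈-++⁻ (steps L) e′
    ...   | inj₁ e∈L = All.lookup (targets-∈ L) e∈L
  ...   | v , v∉L , long with reorder G c (covers-grow G {singleton r} w′ (covers-ordering G ord)) id v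
  ...     | w , ρ₂ , h , ed , c′ , eqv = v , reordered w ρ₂ h lt c′ eqv
    where
    L = loopErase G w₁
    ⊆L : ∀ {t} → t ∈ L ++ r ∷ [] → t ∈ L
    ⊆L t∈ with ∈-++⁻ L t∈
    ... | inj₁ t∈L         = t∈L
    ... | inj₂ (here refl) = root∈loopErase G h₁
    open PathTo (loopErase-path G h)
    any : ∀ {q} → loopErase G w ≡ v ∷ q → Any (_∈ L) q
    any {q} Q≡ = go stem (⊆L tip∈) (trans (sym shape) Q≡)
      where
      go : ∀ s {t} → t ∈ L → s ++ t ∷ [] ≡ v ∷ q → Any (_∈ L) q
      go []      t∈L refl = contradiction t∈L v∉L
      go (_ ∷ s) t∈L refl = Any.++⁺ʳ s (here t∈L)
    -- `length` counts vertices, one more than the number of steps.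
    lt : l ℕ.< length w
    lt with starts
    ... | q , Q≡ = ℕ.≤-trans (s≤s (long q (subst (Along _) Q≡ ed) (any Q≡)))
          (ℕ.≤-trans (ℕ.≤-reflexive (cong length (sym Q≡)))
            (ℕ.≤-trans (erase-length (loopErase-Erase G w)) (ℕ.≤-reflexive (ℕ.+-identityʳ (length w)))))

-- Bounds for sums over countable sets

sum : ∀ {X : Set} → (X → ℚ) → List X → ℚ
sum f xs = foldr _+_ 0ℚ (map f xs)

-- `ProbabilityAtMost` is the instance where `f` is `runProbability` and `A` includes `IsRun`.
AtMost : ∀ {X : Set} → (X → ℚ) → (X → Set) → ℚ → Set
AtMost f A b = ∀ xs → Unique xs → All A xs → sum f xs ≤ b

*-mono-≤ʳ : ∀ {p q} r → 0ℚ ≤ r → p ≤ q → p * r ≤ q * r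
*-mono-≤ʳ r 0≤r = ℚ.*-monoʳ-≤-nonNeg r {{nonNegative 0≤r}}

*-mono-≤ˡ : ∀ {p q} r → 0ℚ ≤ r → p ≤ q → r * p ≤ r * q
*-mono-≤ˡ r 0≤r = ℚ.*-monoˡ-≤-nonNeg r {{nonNegative 0≤r}}

*-nonNeg : ∀ {p q} → 0ℚ ≤ p → 0ℚ ≤ q → 0ℚ ≤ p * q
*-nonNeg {p} {q} 0≤p 0≤q = subst (_≤ p * q) (ℚ.*-zeroʳ p) (*-mono-≤ˡ p 0≤p 0≤q)

module _ {X : Set} where

  sum-mono : ∀ {f g : X → ℚ} xs → (∀ {x} → x ∈ xs → f x ≤ g x) → sum f xs ≤ sum g xs
  sum-mono []       f≤g = ℚ.≤-refl
  sum-mono (x ∷ xs) f≤g = ℚ.+-mono-≤ (f≤g (here refl)) (sum-mono xs (f≤g ∘ there))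

  sum-*ˡ : ∀ (f : X → ℚ) c xs → sum (λ x → c * f x) xs ≡ c * sum f xs
  sum-*ˡ f c []       = sym (ℚ.*-zeroʳ c)
  sum-*ˡ f c (x ∷ xs) = trans (cong (c * f x +_) (sum-*ˡ f c xs)) (sym (ℚ.*-distribˡ-+ c (f x) (sum f xs)))

  sum-*ʳ : ∀ (f : X → ℚ) c xs → sum (λ x → f x * c) xs ≡ sum f xs * c
  sum-*ʳ f c []       = sym (ℚ.*-zeroˡ c)
  sum-*ʳ f c (x ∷ xs) = trans (cong (f x * c +_) (sum-*ʳ f c xs)) (sym (ℚ.*-distribʳ-+ c (f x) (sum f xs)))

  atMost-≤ : ∀ {f : X → ℚ} {A a b} → a ≤ b → AtMost f A a → AtMost f A b
  atMost-≤ a≤b h xs u as = ℚ.≤-trans (h xs u as) a≤b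

  atMost-scale : ∀ {f : X → ℚ} {A a} c → 0ℚ ≤ c → AtMost f A a → AtMost (λ x → c * f x) A (c * a)
  atMost-scale {f} c 0≤c h xs u as = ℚ.≤-trans (ℚ.≤-reflexive (sum-*ˡ f c xs)) (*-mono-≤ˡ c 0≤c (h xs u as))

  atMost-empty : ∀ {f : X → ℚ} {A b} → 0ℚ ≤ b → (∀ {x} → ¬ A x) → AtMost f A b
  atMost-empty 0≤b ¬A []      _ _       = 0≤b
  atMost-empty 0≤b ¬A (x ∷ _) _ (a ∷ _) = contradiction a ¬A

  atMost-single : ∀ {f : X → ℚ} {A b} → 0ℚ ≤ b → (∀ {x} → A x → f x ≤ b) →
                  (∀ {x y} → A x → A y → x ≡ y) → AtMost f A b
  atMost-single 0≤b f≤b one []          _             _           = 0≤b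
  atMost-single 0≤b f≤b one (x ∷ [])    _             (a ∷ _)     = ℚ.≤-trans (ℚ.≤-reflexive (ℚ.+-identityʳ _)) (f≤b a)
  atMost-single 0≤b f≤b one (x ∷ y ∷ _) ((x≢y ∷ _) ∷ _) (a ∷ a′ ∷ _) = contradiction (one a a′) x≢y

  record Split (f : X → ℚ) (A B : X → Set) (xs : List X) : Set where
    field
      left right   : List X
      leftA        : All A left
      rightB       : All B right
      left⊆        : ∀ {x} → x ∈ left → x ∈ xs
      right⊆       : ∀ {x} → x ∈ right → x ∈ xs
      left-unique  : Unique left
      right-unique : Unique right
      total        : sum f xs ≡ sum f left + sum f right

  split : ∀ {f A B} xs → Unique xs → All (λ x → A x ⊎ B x) xs → Split f A B xs
  split []       _       _ = record
    { left = [] ; right = [] ; leftA = [] ; rightB = [] ; left⊆ = id ; right⊆ = id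
    ; left-unique = [] ; right-unique = [] ; total = refl }
  split {f} (x ∷ xs) (x≢ ∷ u) (c ∷ cs) with split {f} xs u cs | c
  ... | s | inj₁ a = record
    { left = x ∷ left ; right = right ; leftA = a ∷ leftA ; rightB = rightB
    ; left⊆ = λ { (here e) → here e ; (there y) → there (left⊆ y) } ; right⊆ = there ∘ right⊆
    ; left-unique = All.tabulate (All.lookup x≢ ∘ left⊆) ∷ left-unique ; right-unique = right-unique
    ; total = trans (cong (f x +_) total) (sym (ℚ.+-assoc (f x) (sum f left) (sum f right))) }
    where open Split s
  ... | s | inj₂ b = record
    { left = left ; right = x ∷ right ; leftA = leftA ; rightB = b ∷ rightB
    ; left⊆ = there ∘ left⊆ ; right⊆ = λ { (here e) → here e ; (there y) → there (right⊆ y) }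
    ; left-unique = left-unique ; right-unique = All.tabulate (All.lookup x≢ ∘ right⊆) ∷ right-unique
    ; total = trans (cong (f x +_) total)
        (trans (sym (ℚ.+-assoc (f x) (sum f left) (sum f right)))
          (trans (cong (_+ sum f right) (ℚ.+-comm (f x) (sum f left)))
                 (ℚ.+-assoc (sum f left) (f x) (sum f right)))) }
    where open Split s

  -- Union bound: each element is counted on the one side that its evidence selects.
  atMost-⊎ : ∀ {f : X → ℚ} {A B a b} → AtMost f A a → AtMost f B b → AtMost f (λ x → A x ⊎ B x) (a + b)
  atMost-⊎ {f} hA hB xs u cs =
    ℚ.≤-trans (ℚ.≤-reflexive total) (ℚ.+-mono-≤ (hA left left-unique leftA) (hB right right-unique rightB))
    where open Split (split {f} xs u cs)

  atMost-⊆ : ∀ {f : X → ℚ} {A B b} → (∀ {x} → A x → B x) → AtMost f B b → AtMost f A b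
  atMost-⊆ A⊆B h xs u as = h xs u (All.map A⊆B as)

  atMost-Any : ∀ {I : Set} {f : X → ℚ} {A : I → X → Set} (b : I → ℚ) is →
               (∀ {i} → i ∈ is → AtMost f (A i) (b i)) →
               AtMost f (λ x → Any (λ i → A i x) is) (sum b is)
  atMost-Any b []       h = atMost-empty ℚ.≤-refl (λ ())
  atMost-Any b (i ∷ is) h = atMost-⊆ Any.toSum (atMost-⊎ (h (here refl)) (atMost-Any b is (h ∘ there)))

  -- A finite list has a largest size, so a bound uniform in `N` suffices; this permits induction on
  -- the length of walks.
  atMost-truncate : ∀ {f : X → ℚ} {A b} (size : X → ℕ) →
                    (∀ N → AtMost f (λ x → A x × size x ℕ.≤ N) b) → AtMost f A b
  atMost-truncate {f} {A} size h xs u as = h (bound xs) xs u (All.zip (as , bounded xs))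
    where
    bound : List X → ℕ
    bound = foldr (λ x n → size x ⊔ n) 0
    bounded : ∀ xs → All (λ x → size x ℕ.≤ bound xs) xs
    bounded []       = []
    bounded (x ∷ xs) = ℕ.m≤m⊔n (size x) (bound xs) ∷
      All.map (λ p → ℕ.≤-trans p (ℕ.m≤n⊔m (size x) (bound xs))) (bounded xs)

module _ {X Y : Set} where

  -- `φ` may depend on the evidence, as the reordered run will depend on the branch found.
  atMost-inject : ∀ {f : X → ℚ} {g : Y → ℚ} {A B b} (φ : ∀ {x} → A x → Y) →
                  (∀ {x} (a : A x) → B (φ a)) → (∀ {x} (a : A x) → f x ≤ g (φ a)) →
                  (∀ {x x′} (a : A x) (a′ : A x′) → φ a ≡ φ a′ → x ≡ x′) →
                  AtMost g B b → AtMost f A b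
  atMost-inject {f} {g} {A} {B} φ φB f≤g inj h xs u as =
    ℚ.≤-trans (sum≤ as) (h (image as) (image-unique u as) (imageB as))
    where
    image : ∀ {xs} → All A xs → List Y
    image []       = []
    image (a ∷ as) = φ a ∷ image as
    imageB : ∀ {xs} (as : All A xs) → All B (image as)
    imageB []       = []
    imageB (a ∷ as) = φB a ∷ imageB as
    fresh-image : ∀ {x xs} (a : A x) (as : All A xs) → All (x ≢_) xs → All (φ a ≢_) (image as)
    fresh-image a []        []         = []
    fresh-image a (a′ ∷ as) (x≢ ∷ x≢s) = (x≢ ∘ inj a a′) ∷ fresh-image a as x≢s
    image-unique : ∀ {xs} → Unique xs → (as : All A xs) → Unique (image as)
    image-unique []       []       = []
    image-unique (x≢ ∷ u) (a ∷ as) = fresh-image a as x≢ ∷ image-unique u as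
    sum≤ : ∀ {xs} (as : All A xs) → sum f xs ≤ sum g (image as)
    sum≤ []       = ℚ.≤-refl
    sum≤ (a ∷ as) = ℚ.+-mono-≤ (f≤g a) (sum≤ as)

module _ {X Y : Set} where

  -- Pairs are grouped by first component: those over `x` contribute at most `f x * b`, and
  -- deduplication makes the list of first components admissible for `hA`.
  atMost-× : DecidableEquality X → ∀ {f : X → ℚ} {g : Y → ℚ} {A : X → Set} {B : X → Y → Set} {a b} →
             (∀ x → 0ℚ ≤ f x) → 0ℚ ≤ b → AtMost f A a → (∀ {x} → A x → AtMost g (B x) b) →
             AtMost (λ (x , y) → f x * g y) (λ (x , y) → A x × B x y) (a * b)
  atMost-× _≟_ {f} {g} {A} {B} {a} {b} 0≤f 0≤b hA hB zs u cs = begin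
    sum (λ (x , y) → f x * g y) zs ≤⟨ atMost-Any (λ x → f x * b) xs fibre zs u classified ⟩
    sum (λ x → f x * b) xs         ≡⟨ sum-*ʳ f b xs ⟩
    sum f xs * b                   ≤⟨ *-mono-≤ʳ b 0≤b (hA xs (Unique.deduplicate-! _≟_ (map proj₁ zs)) (All.tabulate inA)) ⟩
    a * b                          ∎
    where
    open ℚ.≤-Reasoning
    xs = deduplicate _≟_ (map proj₁ zs)
    inA : ∀ {x} → x ∈ xs → A x
    inA x∈ = All.lookup (All.map⁺ (All.map proj₁ cs)) (∈-deduplicate⁻ _≟_ (map proj₁ zs) x∈)
    fibre : ∀ {x} → x ∈ xs → AtMost (λ (x , y) → f x * g y) (λ z → proj₁ z ≡ x × B x (proj₂ z)) (f x * b)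
    fibre {x} x∈ = atMost-inject {B = B x} (λ {z} _ → proj₂ z) proj₂
      (λ { (refl , _) → ℚ.≤-refl }) (λ { (refl , _) (refl , _) refl → refl })
      (atMost-scale (f x) (0≤f x) (hB (inA x∈)))
    classified : All (λ z → Any (λ x → proj₁ z ≡ x × B x (proj₂ z)) xs) zs
    classified = All.tabulate λ {z} z∈ →
      Any.map (λ { refl → refl , proj₂ (All.lookup cs z∈) }) (∈-deduplicate⁺ _≟_ (∈-map⁺ proj₁ z∈))

fromℕ-+ : ∀ j k → fromℕ (j ℕ.+ k) ≡ fromℕ j + fromℕ k
fromℕ-+ j k = ℚ.toℚᵘ-injective (begin-equality
  toℚᵘ (fromℕ (j ℕ.+ k))                ≃⟨ ℚ.toℚᵘ-fromℚᵘ (mkℚᵘ (ℤ.+ (j ℕ.+ k)) 0) ⟩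
  mkℚᵘ (ℤ.+ (j ℕ.+ k)) 0                  ≃⟨ *≡* (cong (ℤ._* ℤ.+ 1) (sym (cong₂ ℤ._+_ (ℤ.*-identityʳ (ℤ.+ j)) (ℤ.*-identityʳ (ℤ.+ k))))) ⟩
  mkℚᵘ (ℤ.+ j) 0 ℚᵘ.+ mkℚᵘ (ℤ.+ k) 0        ≃⟨ ℚᵘ.+-cong (ℚ.toℚᵘ-fromℚᵘ (mkℚᵘ (ℤ.+ j) 0)) (ℚ.toℚᵘ-fromℚᵘ (mkℚᵘ (ℤ.+ k) 0)) ⟨
  toℚᵘ (fromℕ j) ℚᵘ.+ toℚᵘ (fromℕ k)    ≃⟨ ℚ.toℚᵘ-homo-+ (fromℕ j) (fromℕ k) ⟨
  toℚᵘ (fromℕ j + fromℕ k)              ∎)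
  where open ℚᵘ.≤-Reasoning

fromℕ-* : ∀ j k → fromℕ (j ℕ.* k) ≡ fromℕ j * fromℕ k
fromℕ-* zero    k = sym (ℚ.*-zeroˡ (fromℕ k))
fromℕ-* (suc j) k = begin
  fromℕ (k ℕ.+ j ℕ.* k)           ≡⟨ fromℕ-+ k (j ℕ.* k) ⟩
  fromℕ k + fromℕ (j ℕ.* k)       ≡⟨ cong₂ _+_ (sym (ℚ.*-identityˡ (fromℕ k))) (fromℕ-* j k) ⟩
  1ℚ * fromℕ k + fromℕ j * fromℕ k ≡⟨ ℚ.*-distribʳ-+ (fromℕ k) 1ℚ (fromℕ j) ⟨
  (1ℚ + fromℕ j) * fromℕ k        ≡⟨ cong (_* fromℕ k) (fromℕ-+ 1 j) ⟨
  fromℕ (suc j) * fromℕ k         ∎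
  where open ≡-Reasoning

fromℕ-nonNeg : ∀ k → 0ℚ ≤ fromℕ k
fromℕ-nonNeg k = ℚ.nonNegative⁻¹ (fromℕ k) {{ℚ.normalize-nonNeg k 1}}

fromℕ-mono : ∀ {j k} → j ℕ.≤ k → fromℕ j ≤ fromℕ k
fromℕ-mono {j} {k} j≤k = begin
  fromℕ j                     ≡⟨ ℚ.+-identityʳ (fromℕ j) ⟨
  fromℕ j + 0ℚ                ≤⟨ ℚ.+-monoʳ-≤ (fromℕ j) (fromℕ-nonNeg (k ℕ.∸ j)) ⟩
  fromℕ j + fromℕ (k ℕ.∸ j)   ≡⟨ fromℕ-+ j (k ℕ.∸ j) ⟨
  fromℕ (j ℕ.+ (k ℕ.∸ j))     ≡⟨ cong fromℕ (ℕ.m+[n∸m]≡n j≤k) ⟩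
  fromℕ k                     ∎
  where open ℚ.≤-Reasoning

sum-const : ∀ {X : Set} c (xs : List X) → sum (const c) xs ≡ fromℕ (length xs) * c
sum-const c []       = sym (ℚ.*-zeroˡ c)
sum-const c (x ∷ xs) = begin
  c + sum (const c) xs              ≡⟨ cong₂ _+_ (sym (ℚ.*-identityˡ c)) (sum-const c xs) ⟩
  1ℚ * c + fromℕ (length xs) * c    ≡⟨ ℚ.*-distribʳ-+ c 1ℚ (fromℕ (length xs)) ⟨
  (1ℚ + fromℕ (length xs)) * c      ≡⟨ cong (_* c) (fromℕ-+ 1 (length xs)) ⟨
  fromℕ (suc (length xs)) * c       ∎
  where open ≡-Reasoning

-- Every term but one at `x` is estimated by `M`; the extra `M` on the left replaces a subtraction
-- from the number of terms.
sum-peak : ∀ {X : Set} {f : X → ℚ} {M} → (∀ x → f x ≤ M) → ∀ {x xs} → x ∈ xs →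
           sum f xs + M ≤ f x + fromℕ (length xs) * M
sum-peak {f = f} {M} f≤M {x} {y ∷ ys} x∈ = begin
    (f y + sum f ys) + M                  ≤⟨ go x∈ ⟩
    f x + (M + fromℕ (length ys) * M)     ≡⟨ cong (λ p → f x + (p + fromℕ (length ys) * M)) (ℚ.*-identityˡ M) ⟨
    f x + (1ℚ * M + fromℕ (length ys) * M) ≡⟨ cong (λ p → f x + p) (ℚ.*-distribʳ-+ M 1ℚ (fromℕ (length ys))) ⟨
    f x + (1ℚ + fromℕ (length ys)) * M    ≡⟨ cong (λ p → f x + p * M) (fromℕ-+ 1 (length ys)) ⟨
    f x + fromℕ (suc (length ys)) * M     ∎
  where
  open ℚ.≤-Reasoning
  N = fromℕ (length ys) * M
  open +-*-Solver
  go : x ∈ y ∷ ys → (f y + sum f ys) + M ≤ f x + (M + N)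
  go (here refl) = begin
    (f y + sum f ys) + M ≡⟨ solve 3 (λ a b c → (a :+ b) :+ c := a :+ (c :+ b)) refl (f y) (sum f ys) M ⟩
    f y + (M + sum f ys) ≤⟨ ℚ.+-monoʳ-≤ (f y) (ℚ.+-monoʳ-≤ M (ℚ.≤-trans (sum-mono ys (λ {z} _ → f≤M z)) (ℚ.≤-reflexive (sum-const M ys)))) ⟩
    f y + (M + N)        ∎
  go (there x∈) = begin
    (f y + sum f ys) + M ≡⟨ ℚ.+-assoc (f y) (sum f ys) M ⟩
    f y + (sum f ys + M) ≤⟨ ℚ.+-mono-≤ (f≤M y) (sum-peak f≤M x∈) ⟩
    M + (f x + N)        ≡⟨ solve 3 (λ a b c → a :+ (b :+ c) := b :+ (a :+ c)) refl M (f x) N ⟩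
    f x + (M + N)        ∎

-- Powers, the potential and the decay rate

^-nonNeg : ∀ {q} → 0ℚ ≤ q → ∀ k → 0ℚ ≤ q ^ℚ k
^-nonNeg 0≤q zero    = from-yes (0ℚ ℚ.≤? 1ℚ)
^-nonNeg 0≤q (suc k) = *-nonNeg 0≤q (^-nonNeg 0≤q k)

^-≤1 : ∀ {q} → 0ℚ ≤ q → q ≤ 1ℚ → ∀ k → q ^ℚ k ≤ 1ℚ
^-≤1 0≤q q≤1 zero    = ℚ.≤-refl
^-≤1 {q} 0≤q q≤1 (suc k) = ℚ.≤-trans (*-mono-≤ˡ q 0≤q (^-≤1 0≤q q≤1 k)) (ℚ.≤-trans (ℚ.≤-reflexive (ℚ.*-identityʳ q)) q≤1)

^-anti : ∀ {q} → 0ℚ ≤ q → q ≤ 1ℚ → ∀ {j k} → j ℕ.≤ k → q ^ℚ k ≤ q ^ℚ j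
^-anti 0≤q q≤1 {k = k} z≤n = ^-≤1 0≤q q≤1 k
^-anti {q} 0≤q q≤1 (s≤s j≤k) = *-mono-≤ˡ q 0≤q (^-anti 0≤q q≤1 j≤k)

p≤q⇒0≤q-p : ∀ {p q} → p ≤ q → 0ℚ ≤ q - p
p≤q⇒0≤q-p {p} {q} p≤q = subst (_≤ q - p) (ℚ.+-inverseʳ p) (ℚ.+-monoˡ-≤ (ℚ.- p) p≤q)

-- A lower bound for the probability of a given step when degrees are at most 4.
q : ℚ
q = ℤ.+ 1 ℚ./ 4

0≤q : 0ℚ ≤ q
0≤q = from-yes (0ℚ ℚ.≤? q)

q≤1 : q ≤ 1ℚ
q≤1 = from-yes (q ℚ.≤? 1ℚ)

-- The increments shrink by the factor `q`, so that one step closer, taken with probability `q`,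
-- outweighs the remaining steps even if they all lead to the maximal distance.
potential : ℕ → ℚ
potential k = fromℕ 2 - q ^ℚ k

1≤potential : ∀ k → 1ℚ ≤ potential k
1≤potential k = ℚ.+-monoʳ-≤ (fromℕ 2) (ℚ.neg-antimono-≤ (^-≤1 0≤q q≤1 k))

potential≤2 : ∀ k → potential k ≤ fromℕ 2
potential≤2 k = ℚ.+-monoʳ-≤ (fromℕ 2) (ℚ.neg-antimono-≤ (^-nonNeg 0≤q k))

potential-mono : ∀ {j k} → j ℕ.≤ k → potential j ≤ potential k
potential-mono j≤k = ℚ.+-monoʳ-≤ (fromℕ 2) (ℚ.neg-antimono-≤ (^-anti 0≤q q≤1 j≤k))

decayRate : ℕ → ℚ
decayRate K = 1ℚ - q ^ℚ suc K

0<decayRate : ∀ K → 0ℚ ℚ.< decayRate K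
0<decayRate K = ℚ.<-≤-trans (from-yes (0ℚ ℚ.<? 1ℚ - q)) (ℚ.+-monoʳ-≤ 1ℚ (ℚ.neg-antimono-≤
  (ℚ.≤-trans (*-mono-≤ˡ q 0≤q (^-≤1 0≤q q≤1 K)) (ℚ.≤-reflexive (ℚ.*-identityʳ q)))))

^-pos : ∀ {p} → 0ℚ ℚ.< p → ∀ k → 0ℚ ℚ.< p ^ℚ k
^-pos {p} 0<p zero    = from-yes (0ℚ ℚ.<? 1ℚ)
^-pos {p} 0<p (suc k) = subst (ℚ._< p * p ^ℚ k) (ℚ.*-zeroʳ p) (ℚ.*-monoʳ-<-pos p {{ℚ.positive 0<p}} (^-pos 0<p k))

decayRate<1 : ∀ K → decayRate K ℚ.< 1ℚ
decayRate<1 K = ℚ.+-monoʳ-< 1ℚ (ℚ.neg-antimono-< (^-pos (from-yes (0ℚ ℚ.<? q)) (suc K)))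

-- Masses of hitting walks and their exponential decay

module _ (G : FiniteGraph) where

  open FiniteGraph G

  reciprocal-inverse : ∀ d → reciprocal G (suc d) * fromℕ (suc d) ≡ 1ℚ
  reciprocal-inverse d = ℚ.toℚᵘ-injective (begin-equality
    toℚᵘ (reciprocal G (suc d) * fromℕ (suc d))
      ≃⟨ ℚ.toℚᵘ-homo-* (reciprocal G (suc d)) (fromℕ (suc d)) ⟩
    toℚᵘ (reciprocal G (suc d)) ℚᵘ.* toℚᵘ (fromℕ (suc d))
      ≃⟨ ℚᵘ.*-cong (ℚ.toℚᵘ-fromℚᵘ (mkℚᵘ (ℤ.+ 1) d)) (ℚ.toℚᵘ-fromℚᵘ (mkℚᵘ (ℤ.+ suc d) 0)) ⟩
    mkℚᵘ (ℤ.+ 1) d ℚᵘ.* mkℚᵘ (ℤ.+ suc d) 0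
      ≃⟨ *≡* (trans (ℤ.*-identityʳ (ℤ.+ 1 ℤ.* ℤ.+ suc d)) (cong (λ e → ℤ.+ 1 ℤ.* ℤ.+ e) (sym (ℕ.*-identityʳ (suc d))))) ⟩
    ℚᵘ.1ℚᵘ ∎)
    where open ℚᵘ.≤-Reasoning

  reciprocal-nonNeg : ∀ d → 0ℚ ≤ reciprocal G d
  reciprocal-nonNeg zero    = ℚ.≤-refl
  reciprocal-nonNeg (suc d) = ℚ.nonNegative⁻¹ (reciprocal G (suc d)) {{ℚ.normalize-nonNeg 1 (suc d)}}

  walkProbability-nonNeg : ∀ w → 0ℚ ≤ walkProbability G w
  walkProbability-nonNeg []          = from-yes (0ℚ ℚ.≤? 1ℚ)
  walkProbability-nonNeg (x ∷ [])    = from-yes (0ℚ ℚ.≤? 1ℚ)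
  walkProbability-nonNeg (x ∷ y ∷ w) = *-nonNeg (reciprocal-nonNeg (deg x)) (walkProbability-nonNeg (y ∷ w))

  neighbours : V → List V
  neighbours u = filter (adj? u) vertices

  -- First-step analysis: walks are sorted by their second vertex `i`, and dropping the first vertex
  -- removes exactly the factor `reciprocal G (deg u)`.
  atMost-step : ∀ {u} {A : Pred (List V) 0ℓ} (B : V → Pred (List V) 0ℓ) (b : V → ℚ) →
                (∀ {w} → A w → ∃ λ i → ∃ λ w′ → w ≡ u ∷ i ∷ w′ × Adj u i × B i (i ∷ w′)) →
                (∀ i → AtMost (walkProbability G) (B i) (b i)) →
                AtMost (walkProbability G) A (reciprocal G (deg u) * sum b (neighbours u))
  atMost-step {u} {A} B b inv hB = atMost-⊆ classify
    (atMost-≤ (ℚ.≤-reflexive (sum-*ˡ b (reciprocal G (deg u)) (neighbours u)))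
      (atMost-Any (λ i → reciprocal G (deg u) * b i) (neighbours u) λ {i} _ →
        atMost-inject {B = B i} (λ { {w} (w′ , _) → i ∷ w′ }) (λ { (_ , _ , bi) → bi }) (λ { (_ , refl , _) → ℚ.≤-refl })
          (λ { (_ , refl , _) (_ , refl , _) refl → refl })
          (atMost-scale (reciprocal G (deg u)) (reciprocal-nonNeg (deg u)) (hB i))))
    where
    classify : ∀ {w} → A w → Any (λ i → ∃ λ w′ → w ≡ u ∷ i ∷ w′ × B i (i ∷ w′)) (neighbours u)
    classify a with inv a
    ... | i , w′ , w≡ , adj , bi =
      Any.map (λ { refl → w′ , w≡ , bi }) (∈-filter⁺ (adj? u) (complete i) adj)

  average-≤ : ∀ u {c} → 0ℚ ≤ c → reciprocal G (deg u) * sum (const c) (neighbours u) ≤ c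
  average-≤ u {c} 0≤c = ℚ.≤-trans (ℚ.≤-reflexive (cong (reciprocal G (deg u) *_) (sum-const c (neighbours u)))) (go (deg u))
    where
    go : ∀ d → reciprocal G d * (fromℕ d * c) ≤ c
    -- Without neighbours, `reciprocal` takes its default value `0ℚ`.
    go zero    = ℚ.≤-trans (ℚ.≤-reflexive (ℚ.*-zeroˡ (0ℚ * c))) 0≤c
    go (suc d) = ℚ.≤-reflexive (trans (sym (ℚ.*-assoc (reciprocal G (suc d)) (fromℕ (suc d)) c))
                   (trans (cong (_* c) (reciprocal-inverse d)) (ℚ.*-identityˡ c)))

  walk-mass : ∀ {S : Pred V 0ℓ} → Decidable S → ∀ u → AtMost (walkProbability G) (HittingWalk G S u) 1ℚ
  walk-mass {S} S? u = atMost-truncate length (λ N → bounded N u)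
    where
    0≤1 = from-yes (0ℚ ℚ.≤? 1ℚ)
    bounded : ∀ N u → AtMost (walkProbability G) (λ w → HittingWalk G S u w × length w ℕ.≤ N) 1ℚ
    bounded zero    u = atMost-empty 0≤1 λ { (hit _ , ()) ; (step _ _ _ , ()) }
    bounded (suc N) u with S? u
    ... | yes s = atMost-single 0≤1
      (λ { (hit _ , _) → ℚ.≤-refl ; (step n _ _ , _) → contradiction s n })
      (λ { (hit _ , _) (hit _ , _) → refl ; (step n _ _ , _) _ → contradiction s n ; _ (step n _ _ , _) → contradiction s n })
    ... | no ¬s = atMost-≤ (average-≤ u 0≤1)
      (atMost-step (λ i w → HittingWalk G S i w × length w ℕ.≤ N) (const 1ℚ) inv (bounded N))
      where
      inv : ∀ {w} → HittingWalk G S u w × length w ℕ.≤ suc N → _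
      inv (hit s , _) = contradiction s ¬s
      inv (step _ a h , s≤s ≤N) with hitting-head G h
      ... | w′ , refl = _ , w′ , refl , a , h , ≤N

  -- `κ` is an upper bound for the distance to `S`, witnessed by paths along which it drops by one;
  -- it may be positive on `S`.
  module Decay {S : Pred V 0ℓ} (S? : Decidable S) (κ : V → ℕ) (K : ℕ) (κ≤K : ∀ u → κ u ℕ.≤ K)
               (κ-zero : ∀ {u} → κ u ≡ 0 → S u)
               (κ-suc : ∀ {u k} → κ u ≡ suc k → ∃ λ v → Adj u v × κ v ≡ k)
               (deg≤4 : ∀ u → fromℕ (deg u) ≤ fromℕ 4) where

    θ : ℚ
    θ = decayRate K

    0≤θ : 0ℚ ≤ θ
    0≤θ = ℚ.<⇒≤ (0<decayRate K)

    contraction : ∀ {k} → k ℕ.≤ K →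
                  potential K - q * (potential K - potential k) ≤ potential (suc k) * θ
    contraction {k} k≤K = begin
      potential K - q * (potential K - potential k)   ≡⟨ ℚ.+-identityʳ _ ⟨
      (potential K - q * (potential K - potential k)) + 0ℚ
        -- The slack is chosen so that the next line is an identity; that identity uses that 4 times
        -- `q` is 1.
        ≤⟨ ℚ.+-monoʳ-≤ (potential K - q * (potential K - potential k)) (ℚ.+-mono-≤ (*-nonNeg 0≤q 0≤A) (*-nonNeg (*-nonNeg 0≤q 0≤q) (*-nonNeg 0≤a 0≤A))) ⟩
      (potential K - q * (potential K - potential k)) + (q * A + q * q * (a * A))
        ≡⟨ solve 2 (λ a A → ((con (fromℕ 2) :- A) :- con q :* ((con (fromℕ 2) :- A) :- (con (fromℕ 2) :- a))) :+ (con q :* A :+ con q :* con q :* (a :* A))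
                   := (con (fromℕ 2) :- con q :* a) :* (con 1ℚ :- con q :* A)) refl a A ⟩
      potential (suc k) * θ ∎
      where
      open ℚ.≤-Reasoning
      open +-*-Solver
      a = q ^ℚ k
      A = q ^ℚ K
      0≤a = ^-nonNeg 0≤q k
      0≤A = ^-nonNeg 0≤q K

    -- One neighbour is closer to S, and all others have potential at most that of K.
    average-potential : ∀ {u k} → κ u ≡ suc k →
      reciprocal G (deg u) * sum (potential ∘ κ) (neighbours u) ≤ potential (suc k) * θ
    average-potential {u} {k} κu with κ-suc κu
    ... | v , adj , refl = begin
      ρ * Σ                       ≡⟨ solve 3 (λ ρ Σ M → ρ :* Σ := ρ :* ((Σ :+ M) :- M)) refl ρ Σ M ⟩
      ρ * ((Σ + M) - M)           ≤⟨ *-mono-≤ˡ ρ 0≤ρ (ℚ.+-monoˡ-≤ (ℚ.- M) (sum-peak (λ x → potential-mono (κ≤K x)) v∈)) ⟩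
      ρ * ((p + D * M) - M)       ≡⟨ solve 4 (λ ρ p D M → ρ :* ((p :+ D :* M) :- M) := ρ :* D :* M :- ρ :* (M :- p)) refl ρ p D M ⟩
      ρ * D * M - ρ * (M - p)     ≡⟨ cong (λ e → e * M - ρ * (M - p)) ρD≡1 ⟩
      1ℚ * M - ρ * (M - p)        ≡⟨ cong (_- ρ * (M - p)) (ℚ.*-identityˡ M) ⟩
      M - ρ * (M - p)             ≤⟨ ℚ.+-monoʳ-≤ M (ℚ.neg-antimono-≤ (*-mono-≤ʳ (M - p) (p≤q⇒0≤q-p (potential-mono (κ≤K v))) q≤ρ)) ⟩
      M - q * (M - p)             ≤⟨ contraction (κ≤K v) ⟩
      potential (suc (κ v)) * θ   ∎
      where
      open ℚ.≤-Reasoning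
      open +-*-Solver
      ρ = reciprocal G (deg u)
      Σ = sum (potential ∘ κ) (neighbours u)
      M = potential K
      D = fromℕ (deg u)
      p = potential (κ v)
      0≤ρ = reciprocal-nonNeg (deg u)
      v∈ : v ∈ neighbours u
      v∈ = ∈-filter⁺ (adj? u) (complete v) adj
      inverse : ∀ {X : Set} {x : X} {xs} → x ∈ xs → reciprocal G (length xs) * fromℕ (length xs) ≡ 1ℚ
      inverse {xs = _ ∷ xs} _ = reciprocal-inverse (length xs)
      ρD≡1 : ρ * D ≡ 1ℚ
      ρD≡1 = inverse v∈
      q≤ρ : q ≤ ρ
      q≤ρ = begin
        q             ≡⟨ ℚ.*-identityʳ q ⟨
        q * 1ℚ        ≡⟨ cong (q *_) ρD≡1 ⟨
        q * (ρ * D)   ≤⟨ *-mono-≤ˡ q 0≤q (*-mono-≤ˡ ρ 0≤ρ (deg≤4 u)) ⟩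
        q * (ρ * fromℕ 4) ≡⟨ solve 1 (λ ρ → con q :* (ρ :* con (fromℕ 4)) := ρ) refl ρ ⟩
        ρ             ∎

    -- Induction on `l` by first-step analysis: the potential is at least 1 at the start of the
    -- induction, and each step contracts its average by `θ`.
    decay : ∀ l u → AtMost (walkProbability G) (λ w → HittingWalk G S u w × l ℕ.< length w)
                           (potential (κ u) * θ ^ℚ l)
    decay zero u = atMost-≤ (ℚ.≤-trans (1≤potential (κ u)) (ℚ.≤-reflexive (sym (ℚ.*-identityʳ _))))
      (atMost-⊆ proj₁ (walk-mass S? u))
    decay (suc l) u = go (κ u) refl
      where
      inv : ∀ {w} → HittingWalk G S u w × suc l ℕ.< length w → _
      inv (hit _ , s≤s ())
      inv (step _ a h , s≤s l<) with hitting-head G h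
      ... | w′ , refl = _ , w′ , refl , a , h , l<
      go : ∀ k → κ u ≡ k → AtMost _ _ (potential (κ u) * θ ^ℚ suc l)
      -- Here `u` lies in `S`, so the only walk is the trivial one, which is too short.
      go zero κu = atMost-empty (*-nonNeg (ℚ.≤-trans (from-yes (0ℚ ℚ.≤? 1ℚ)) (1≤potential (κ u))) (^-nonNeg 0≤θ (suc l)))
        λ { (hit _ , s≤s ()) ; (step n _ _ , _) → n (κ-zero κu) }
      go (suc k) κu = atMost-≤ bound
        (atMost-step (λ i w → HittingWalk G S i w × l ℕ.< length w) (λ i → potential (κ i) * θ ^ℚ l) inv (decay l))
        where
        open ℚ.≤-Reasoning
        bound : reciprocal G (deg u) * sum (λ i → potential (κ i) * θ ^ℚ l) (neighbours u) ≤ potential (κ u) * θ ^ℚ suc l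
        bound = begin
          reciprocal G (deg u) * sum (λ i → potential (κ i) * θ ^ℚ l) (neighbours u)
            ≡⟨ cong (reciprocal G (deg u) *_) (sum-*ʳ (potential ∘ κ) (θ ^ℚ l) (neighbours u)) ⟩
          reciprocal G (deg u) * (sum (potential ∘ κ) (neighbours u) * θ ^ℚ l)
            ≡⟨ ℚ.*-assoc (reciprocal G (deg u)) _ _ ⟨
          reciprocal G (deg u) * sum (potential ∘ κ) (neighbours u) * θ ^ℚ l
            ≤⟨ *-mono-≤ʳ (θ ^ℚ l) (^-nonNeg 0≤θ l) (average-potential κu) ⟩
          potential (suc k) * θ * θ ^ℚ l
            ≡⟨ ℚ.*-assoc (potential (suc k)) θ (θ ^ℚ l) ⟩
          potential (suc k) * θ ^ℚ suc l
            ≡⟨ cong (λ j → potential j * θ ^ℚ suc l) κu ⟨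
          potential (κ u) * θ ^ℚ suc l ∎

-- Masses of runs

module _ (G : FiniteGraph) where

  open FiniteGraph G
  open DecMembership _≟_ using (_∈?_)

  run-mass : ∀ S o → AtMost (runProbability G) (Completes G S o) 1ℚ
  run-mass S []      = atMost-single (from-yes (0ℚ ℚ.≤? 1ℚ)) (λ { done → ℚ.≤-refl }) (λ { done done → refl })
  run-mass S (v ∷ o) with v ∈? verts S
  ... | yes v∈ = atMost-⊆ (λ { (skip _ c) → c ; (walk v∉ _ _) → contradiction v∈ v∉ }) (run-mass S o)
  ... | no  v∉ = atMost-≤ (ℚ.≤-reflexive (ℚ.*-identityʳ 1ℚ))
    (atMost-inject {B = λ (w , ρ) → HittingWalk G (_∈ verts S) v w × Completes G (grow G S w) o ρ}
      pair pair∈ pair-≤ pair-inj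
      (atMost-× (≡-dec _≟_) (walkProbability-nonNeg G) (from-yes (0ℚ ℚ.≤? 1ℚ))
        (walk-mass G (_∈? verts S) v) (λ {w} _ → run-mass (grow G S w) o)))
    where
    pair : ∀ {ρ} → Completes G S (v ∷ o) ρ → List V × Run G
    pair (skip v∈ _)           = contradiction v∈ v∉
    pair (walk {w = w} {ρ} _ _ _) = w , ρ
    pair∈ : ∀ {ρ} (c : Completes G S (v ∷ o) ρ) → _
    pair∈ (skip v∈ _)  = contradiction v∈ v∉
    pair∈ (walk _ h c) = h , c
    pair-≤ : ∀ {ρ} (c : Completes G S (v ∷ o) ρ) → _
    pair-≤ (skip v∈ _)  = contradiction v∈ v∉
    pair-≤ (walk _ h c) = ℚ.≤-refl
    pair-inj : ∀ {ρ ρ′} (c : Completes G S (v ∷ o) ρ) (c′ : Completes G S (v ∷ o) ρ′) → pair c ≡ pair c′ → ρ ≡ ρ′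
    pair-inj (skip v∈ _)  _            _    = contradiction v∈ v∉
    pair-inj (walk _ _ _) (skip v∈ _)  _    = contradiction v∈ v∉
    pair-inj (walk _ _ _) (walk _ _ _) refl = refl

  -- Wilson's algorithm may be continued from v instead, so only the walk from v
  -- to the first path matters for the length of the branch containing v.
  branch-mass : ∀ {r x o l c} → IsOrdering G r (x ∷ o) → 0ℚ ≤ c →
    (∀ {w₁} → HittingWalk G (_∈ r ∷ []) x w₁ → ∀ v →
      AtMost (walkProbability G) (λ w → HittingWalk G (_∈ verts (grow G (singleton r) w₁)) v w × l ℕ.< length w) c) →
    AtMost (runProbability G) (λ ω → IsRun G r (x ∷ o) ω × HasBranchOfLengthAtLeast (finalTree G r ω) (firstPath G ω) l)
      (fromℕ (length vertices) * c)
  branch-mass {r} {x} {o} {l} {c} ord 0≤c hw = atMost-⊆ classify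
    (atMost-≤ (ℚ.≤-reflexive (sum-const c vertices))
      (atMost-Any (λ _ → c) vertices (λ {v} _ → fibre v)))
    where
    0≤1 = from-yes (0ℚ ℚ.≤? 1ℚ)
    Long : V → Run G → Set
    Long v ω = ∃ λ w₁ → ∃ λ ρ → ω ≡ w₁ ∷ ρ × HittingWalk G (_∈ r ∷ []) x w₁ ×
                 Completes G (grow G (singleton r) w₁) o ρ × Reordered G r w₁ o ρ l v
    classify : ∀ {ω} → _ → Any (λ v → Long v ω) vertices
    classify (skip (here refl) _ , _) = contradiction refl (Equivalence.to (proj₂ ord x) (here refl))
    classify (walk _ h c , br) with branch⇒reordered G ord h c br
    ... | v , re = Any.map (λ { refl → _ , _ , refl , h , c , re }) (complete v)
    probability : ∀ {ω v} (e : Long v ω) → let w₁ , _ , _ , _ , _ , re = e in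
      runProbability G ω ≤ walkProbability G w₁ * (walkProbability G (Reordered.w re) * runProbability G (Reordered.ρ′ re))
    probability (w₁ , ρ , refl , _ , _ , reordered w ρ′ _ _ _ eqv) = ℚ.≤-reflexive (cong (walkProbability G w₁ *_)
      (trans (runProbability≡weight G ρ) (trans (weight-~ G eqv) (sym (runProbability≡weight G (w ∷ ρ′))))))
    -- Equal images force equivalent stacks, and the stacks determine the run after the common first
    -- walk.
    determined : ∀ {ω ω′ v} (e : Long v ω) (e′ : Long v ω′) → _ → ω ≡ ω′
    determined (w₁ , ρ , refl , _ , c , reordered w ρ′ _ _ _ eqv) (_ , _ , refl , _ , c′ , reordered _ _ _ _ _ eqv′) refl =
      cong (w₁ ∷_) (run-determined G c c′ (exits-~ _≟_ (~-trans eqv (~-sym eqv′))))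
    -- The image consists of the first walk, the walk from `v` and the completion, of mass at most
    -- `1ℚ`, `c` and `1ℚ`.
    fibre : ∀ v → AtMost (runProbability G) (Long v) c
    fibre v = atMost-≤ (ℚ.≤-reflexive (trans (ℚ.*-identityˡ (c * 1ℚ)) (ℚ.*-identityʳ c)))
      (atMost-inject
        {B = λ (w₁ , w , ρ′) → HittingWalk G (_∈ r ∷ []) x w₁ ×
             (HittingWalk G (_∈ verts (grow G (singleton r) w₁)) v w × l ℕ.< length w) ×
             Completes G (grow G (grow G (singleton r) w₁) w) o ρ′}
        (λ (w₁ , _ , _ , _ , _ , re) → w₁ , Reordered.w re , Reordered.ρ′ re)
        (λ (_ , _ , _ , h , _ , reordered _ _ h′ long c′ _) → h , (h′ , long) , c′)
        probability determined
        (atMost-× (≡-dec _≟_) (walkProbability-nonNeg G) (*-nonNeg 0≤c 0≤1)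
          (walk-mass G (_∈? (r ∷ [])) x)
          (λ {w₁} h → atMost-× (≡-dec _≟_) (walkProbability-nonNeg G) 0≤1 (hw h v)
            (λ {w} _ → run-mass (grow G (grow G (singleton r) w₁) w) o))))

-- The cylinder

length-cartesianProduct : ∀ {A B : Set} (xs : List A) (ys : List B) →
                          length (cartesianProduct xs ys) ≡ length xs ℕ.* length ys
length-cartesianProduct []       ys = refl
length-cartesianProduct (x ∷ xs) ys = trans (length-++ (map (x ,_) ys))
  (cong₂ ℕ._+_ (length-map (x ,_) ys) (length-cartesianProduct xs ys))

module Cylinder (n m : ℕ) where

  G : FiniteGraph
  G = cylinder n m

  open FiniteGraph G

  level : V → ℕ
  level (_ , j) = toℕ j

  level-adj : ∀ {u v} → Adj u v → level v ℕ.≤ suc (level u)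
  level-adj (fwd (around _)) = ℕ.n≤1+n _
  level-adj (fwd (along e))  = ℕ.≤-reflexive e
  level-adj (bwd (around _)) = ℕ.n≤1+n _
  level-adj (bwd (along e))  = ℕ.≤-trans (ℕ.n≤1+n _) (ℕ.≤-trans (ℕ.≤-reflexive (sym e)) (ℕ.n≤1+n _))

  -- Discrete intermediate values: below level `k` the next vertex is still at level at most `k`,
  -- which renews the hypothesis `lo` for the tail; above level `k` the same holds for `hi`.
  meets-level : ∀ {k} w → Along Adj w → Any (λ v → level v ℕ.≤ k) w → Any (λ v → k ℕ.≤ level v) w →
                Any (Ring k) w
  meets-level {k} (v ∷ w) as lo hi with ℕ.<-cmp (level v) k
  meets-level (v ∷ w) as lo hi | tri≈ _ e _ = here e
  meets-level (v ∷ w) as lo (here k≤v) | tri< v<k _ _ = contradiction k≤v (ℕ.<⇒≱ v<k)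
  meets-level (v ∷ x ∷ w) (a ∷ as) lo (there hi) | tri< v<k _ _ =
    there (meets-level (x ∷ w) as (here (ℕ.≤-trans (level-adj a) v<k)) hi)
  meets-level (v ∷ w) as (here v≤k) hi | tri> _ _ k<v = contradiction v≤k (ℕ.<⇒≱ k<v)
  meets-level (v ∷ x ∷ w) (a ∷ as) (there lo) hi | tri> _ _ k<v =
    there (meets-level (x ∷ w) as lo (here (ℕ.≤-pred (ℕ.≤-trans k<v (level-adj (adj-sym a))))))

  successor : Fin n → ℕ
  successor i = _%_ (suc (toℕ i)) n {{Fin.nonZeroIndex i}}

  successor-inside : ∀ i → suc (toℕ i) ℕ.< n → successor i ≡ suc (toℕ i)
  successor-inside i = m<n⇒m%n≡m {{Fin.nonZeroIndex i}}

  successor-wraps : ∀ i → suc (toℕ i) ≡ n → successor i ≡ 0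
  successor-wraps i e = trans (cong (λ a → _%_ a n {{Fin.nonZeroIndex i}}) e) (n%n≡0 n {{Fin.nonZeroIndex i}})

  successor-injective : ∀ {i i′} → successor i ≡ successor i′ → i ≡ i′
  successor-injective {i} {i′} eq with ℕ.m≤n⇒m<n∨m≡n (Fin.toℕ<n i) | ℕ.m≤n⇒m<n∨m≡n (Fin.toℕ<n i′)
  ... | inj₁ lt | inj₁ lt′ = Fin.toℕ-injective (ℕ.suc-injective
    (trans (sym (successor-inside i lt)) (trans eq (successor-inside i′ lt′))))
  ... | inj₂ e  | inj₂ e′  = Fin.toℕ-injective (ℕ.suc-injective (trans e (sym e′)))
  ... | inj₁ lt | inj₂ e′  = contradiction (trans (sym (successor-inside i lt)) (trans eq (successor-wraps i′ e′))) λ ()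
  ... | inj₂ e  | inj₁ lt′ = contradiction (trans (sym (successor-inside i′ lt′)) (trans (sym eq) (successor-wraps i e))) λ ()

  Turn Rise : V → V → Set
  Turn (i , j) (i′ , j′) = toℕ i′ ≡ successor i × j ≡ j′
  Rise (i , j) (i′ , j′) = toℕ j′ ≡ suc (toℕ j) × i ≡ i′

  -- The degree is a sum of ones over distinct neighbours. By the union bound it suffices that each
  -- of the four directions contains at most one of them.
  deg≤4 : ∀ u → fromℕ (deg u) ≤ fromℕ 4
  deg≤4 u = ℚ.≤-trans (ℚ.≤-reflexive (trans (sym (ℚ.*-identityʳ _)) (sym (sum-const 1ℚ (neighbours G u)))))
    (atMost-⊆ {B = (Turn u ∪ Rise u) ∪ ((λ v → Turn v u) ∪ (λ v → Rise v u))}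
      (λ { (fwd (around e)) → inj₁ (inj₁ (e , refl)) ; (fwd (along e)) → inj₁ (inj₂ (e , refl))
         ; (bwd (around e)) → inj₂ (inj₁ (e , refl)) ; (bwd (along e)) → inj₂ (inj₂ (e , refl)) })
      (atMost-⊎
        (atMost-⊎ (single λ { (e , refl) (e′ , refl) → cong (_, proj₂ u) (Fin.toℕ-injective (trans e (sym e′))) })
                  (single λ { (e , refl) (e′ , refl) → cong (proj₁ u ,_) (Fin.toℕ-injective (trans e (sym e′))) }))
        (atMost-⊎ (single λ { (e , refl) (e′ , refl) → cong (_, proj₂ u) (successor-injective (trans (sym e) e′)) })
                  (single λ { (e , refl) (e′ , refl) → cong (proj₁ u ,_) (Fin.toℕ-injective (ℕ.suc-injective (trans (sym e) e′))) })))
      (neighbours G u) (Uniq.filter⁺ (adj? u) unique) (All.tabulate λ v∈ → proj₂ (∈-filter⁻ (adj? u) {xs = vertices} v∈)))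
    where
    single : ∀ {A : V → Set} → (∀ {v v′} → A v → A v′ → v ≡ v′) → AtMost (λ _ → 1ℚ) A 1ℚ
    single = atMost-single (from-yes (0ℚ ℚ.≤? 1ℚ)) (λ _ → ℚ.≤-refl)

  module Approach (column : Fin m → Fin n) where

    -- Measured without wrapping around the cycle, which can only overestimate the distance in the
    -- ring and still never exceeds `n`.
    distance : V → ℕ
    distance (i , j) = ℕ.∣ toℕ i - toℕ (column j) ∣

    distance≤n : ∀ u → distance u ℕ.≤ n
    distance≤n (i , j) = ℕ.≤-trans (ℕ.∣m-n∣≤m⊔n (toℕ i) (toℕ (column j)))
      (ℕ.⊔-lub (ℕ.<⇒≤ (Fin.toℕ<n i)) (ℕ.<⇒≤ (Fin.toℕ<n (column j))))

    closer : ∀ {a b k} → ℕ.∣ a - b ∣ ≡ suc k →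
             (a ℕ.< b × ℕ.∣ suc a - b ∣ ≡ k) ⊎ (∃ λ a′ → a ≡ suc a′ × ℕ.∣ a′ - b ∣ ≡ k)
    closer {zero}  {suc b} refl = inj₁ (s≤s z≤n , refl)
    closer {suc a} {zero}  refl = inj₂ (a , refl , ℕ.∣-∣-identityʳ a)
    closer {suc a} {suc b} e with closer {a} {b} e
    ... | inj₁ (lt , e′)        = inj₁ (s≤s lt , e′)
    ... | inj₂ (a′ , refl , e′) = inj₂ (suc a′ , refl , e′)

    distance-suc : ∀ {u k} → distance u ≡ suc k → ∃ λ v → Adj u v × distance v ≡ k
    distance-suc {i , j} {k} e with closer e
    ... | inj₁ (lt , e′) = (fromℕ< i+1<n , j) ,
        fwd (around (trans (Fin.toℕ-fromℕ< i+1<n) (sym (successor-inside i i+1<n)))) ,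
        trans (cong (λ a → ℕ.∣ a - toℕ (column j) ∣) (Fin.toℕ-fromℕ< i+1<n)) e′
      where
      i+1<n : suc (toℕ i) ℕ.< n
      i+1<n = ℕ.≤-<-trans lt (Fin.toℕ<n (column j))
    ... | inj₂ (a , i≡ , e′) = (fromℕ< a<n , j) ,
        bwd (around (trans i≡ (trans (cong suc (sym a≡)) (sym (successor-inside (fromℕ< a<n) lt))))) ,
        trans (cong (λ a → ℕ.∣ a - toℕ (column j) ∣) a≡) e′
      where
      a<n : a ℕ.< n
      a<n = ℕ.<-trans (ℕ.≤-reflexive (sym i≡)) (Fin.toℕ<n i)
      a≡ : toℕ (fromℕ< a<n) ≡ a
      a≡ = Fin.toℕ-fromℕ< a<n
      lt : suc (toℕ (fromℕ< a<n)) ℕ.< n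
      lt = subst (ℕ._< n) (trans i≡ (cong suc (sym a≡))) (Fin.toℕ<n i)

  walk-decay : ∀ S → (∀ k → k ℕ.< m → Any (Ring k) S) → ∀ l v →
    AtMost (walkProbability G) (λ w → HittingWalk G (_∈ S) v w × l ℕ.< length w) (fromℕ 2 * decayRate n ^ℚ l)
  walk-decay S meets l v = atMost-≤ (*-mono-≤ʳ (decayRate n ^ℚ l) (^-nonNeg (ℚ.<⇒≤ (0<decayRate n)) l) (potential≤2 (distance v)))
    (decay l v)
    where
    open DecMembership _≟_ using (_∈?_)
    member : ∀ j → ∃ λ i → (i , j) ∈ S
    member j = go (meets (toℕ j) (Fin.toℕ<n j))
      where
      go : ∀ {S} → Any (Ring (toℕ j)) S → ∃ λ i → (i , j) ∈ S
      go (here {i , j′} e) = i , here (cong (i ,_) (sym (Fin.toℕ-injective e)))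
      go (there any)       = let i , ∈S = go any in i , there ∈S
    open Approach (proj₁ ∘ member)
    open Decay G (_∈? S) distance n distance≤n
      (λ {u} e → subst (_∈ S) (cong (_, proj₂ u) (sym (Fin.toℕ-injective (ℕ.∣m-n∣≡0⇒m≡n e)))) (proj₂ (member (proj₂ u))))
      distance-suc deg≤4

  crossing-meets-rings : ∀ {r x w} → OppositeBoundaries r x → HittingWalk G (_∈ r ∷ []) x w →
                         ∀ k → k ℕ.< m → Any (Ring k) (loopErase G w)
  crossing-meets-rings {r} {x} {w} opp h k k<m = meets-level (loopErase G w) (PathTo.path br) (lo opp) (hi opp)
    where
    br = loopErase-path G h
    x∈ : x ∈ loopErase G w
    x∈ = let _ , e = PathTo.starts br in subst (x ∈_) (sym e) (here refl)
    r∈ = root∈loopErase G h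
    k≤m-1 : k ℕ.≤ m ℕ.∸ 1
    k≤m-1 = ℕ.∸-monoˡ-≤ 1 k<m
    bottom : ∀ {v} → Ring 0 v → level v ℕ.≤ k
    bottom e = ℕ.≤-trans (ℕ.≤-reflexive e) z≤n
    top : ∀ {v} → Ring (m ℕ.∸ 1) v → k ℕ.≤ level v
    top e = ℕ.≤-trans k≤m-1 (ℕ.≤-reflexive (sym e))
    lo : OppositeBoundaries r x → Any (λ v → level v ℕ.≤ k) (loopErase G w)
    lo (inj₁ (r0 , _)) = Any.map (λ { refl → bottom {r} r0 }) r∈
    lo (inj₂ (_ , x0)) = Any.map (λ { refl → bottom {x} x0 }) x∈
    hi : OppositeBoundaries r x → Any (λ v → k ℕ.≤ level v) (loopErase G w)
    hi (inj₁ (_ , xm)) = Any.map (λ { refl → top {x} xm }) x∈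
    hi (inj₂ (rm , _)) = Any.map (λ { refl → top {r} rm }) r∈

  firstPath-isTrunk : ∀ {r x o ω} → OppositeBoundaries r x → IsOrdering G r (x ∷ o) → IsRun G r (x ∷ o) ω →
                      IsTrunk (finalTree G r ω) (firstPath G ω)
  firstPath-isTrunk opp ord (skip (here refl) _) = contradiction refl (Equivalence.to (proj₂ ord _) (here refl))
  firstPath-isTrunk {r} opp ord c@(walk {w = w} {ρ} _ h _) = record
    { spanningTree = isSpanningTree G ord c
    ; simplePath   = PathTo.simple (loopErase-path G h) ,
        along⇒linked (loopErase G w) (All.tabulate λ e → fwd (edges-grows G (grow G (singleton r) w) ρ (∈-++⁺ˡ e)))
    ; meetsRings   = crossing-meets-rings opp h
    }

  length-vertices : length vertices ≡ n ℕ.* m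
  length-vertices = trans (length-cartesianProduct (allFin n) (allFin m))
    (cong₂ ℕ._*_ (length-tabulate {n = n} id) (length-tabulate {n = m} id))

-- Collecting the constants

fromℕ≤2*pred : ∀ {n} → 2 ℕ.≤ n → fromℕ n ≤ fromℕ 2 * fromℕ (n ℕ.∸ 1)
fromℕ≤2*pred {suc (suc n)} (s≤s (s≤s z≤n)) = ℚ.≤-trans (fromℕ-mono (s≤s (ℕ.m≤n+m (suc n) n)))
  (ℚ.≤-reflexive (trans (cong fromℕ (cong suc (trans (ℕ.+-suc n n) (trans (sym (ℕ.+-suc n n)) (cong (n ℕ.+_) (sym (ℕ.+-identityʳ (suc n)))))))) (fromℕ-* 2 (suc n))))

theorem1 : ∀ (n : ℕ) → 3 ℕ.≤ n →
    ∃ λ (C : ℚ) → ∃ λ (θ : ℚ) →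
      (0ℚ ℚ.< C) × (0ℚ ℚ.< θ) × (θ ℚ.< 1ℚ) ×
      (∀ (m : ℕ) → 2 ℕ.≤ m →
       ∀ (r x : CylinderVertex n m) → OppositeBoundaries r x →
       ∀ (o : List (CylinderVertex n m)) → IsOrdering (cylinder n m) r (x ∷ o) →
         (∀ (ω : Run (cylinder n m)) → IsRun (cylinder n m) r (x ∷ o) ω →
            IsTrunk (finalTree (cylinder n m) r ω) (firstPath (cylinder n m) ω))
         ×
         (∀ (l : ℕ) →
            ProbabilityAtMost (cylinder n m) r (x ∷ o)
              (λ ω → HasBranchOfLengthAtLeast (finalTree (cylinder n m) r ω) (firstPath (cylinder n m) ω) l)
              (C * fromℕ m * fromℕ (n ℕ.∸ 1) * θ ^ℚ l)))
theorem1 n 3≤n = fromℕ 4 , decayRate n , from-yes (0ℚ ℚ.<? fromℕ 4) , 0<decayRate n , decayRate<1 n ,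
  λ m _ r x opp o ord → let open Cylinder n m in
    (λ ω → firstPath-isTrunk opp ord) ,
    λ l → atMost-≤ (bound m l)
      (branch-mass G ord (*-nonNeg (fromℕ-nonNeg 2) (Θ-nonNeg l))
        (λ {w₁} h → walk-decay (verts (grow G (singleton r) w₁))
          -- The tree after the first walk contains the first path, which already meets every ring.
          (λ k k<m → Any.++⁺ˡ (crossing-meets-rings opp h k k<m)) l))
  where
  Θ-nonNeg : ∀ l → 0ℚ ≤ decayRate n ^ℚ l
  Θ-nonNeg = ^-nonNeg (ℚ.<⇒≤ (0<decayRate n))
  bound : ∀ m l → fromℕ (length (FiniteGraph.vertices (cylinder n m))) * (fromℕ 2 * decayRate n ^ℚ l)
                  ≤ fromℕ 4 * fromℕ m * fromℕ (n ℕ.∸ 1) * decayRate n ^ℚ l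
  -- The constant 4 is the bound 2 for the potential times the 2 lost in replacing `n` by `n ℕ.∸ 1`.
  bound m l = begin
    fromℕ (length (FiniteGraph.vertices (cylinder n m))) * (fromℕ 2 * Θ)
      ≡⟨ cong (λ k → fromℕ k * (fromℕ 2 * Θ)) (Cylinder.length-vertices n m) ⟩
    fromℕ (n ℕ.* m) * (fromℕ 2 * Θ)
      ≡⟨ cong (_* (fromℕ 2 * Θ)) (fromℕ-* n m) ⟩
    fromℕ n * fromℕ m * (fromℕ 2 * Θ)
      ≤⟨ *-mono-≤ʳ (fromℕ 2 * Θ) (*-nonNeg (fromℕ-nonNeg 2) (Θ-nonNeg l))
           (*-mono-≤ʳ (fromℕ m) (fromℕ-nonNeg m) (fromℕ≤2*pred (ℕ.<⇒≤ 3≤n))) ⟩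
    fromℕ 2 * fromℕ (n ℕ.∸ 1) * fromℕ m * (fromℕ 2 * Θ)
      ≡⟨ solve 3 (λ a b c → con (fromℕ 2) :* a :* b :* (con (fromℕ 2) :* c) := con (fromℕ 4) :* b :* a :* c)
           refl (fromℕ (n ℕ.∸ 1)) (fromℕ m) Θ ⟩
    fromℕ 4 * fromℕ m * fromℕ (n ℕ.∸ 1) * Θ ∎
    where
    open ℚ.≤-Reasoning
    open +-*-Solver
    Θ = decayRate n ^ℚ l
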